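{- Let $n$ be a positive integer and let $F_n$ be the friendship graph. If $G$ is a connected finite simple graph whose adjacency matrix has the same multiset of eigenvalues as the adjacency matrix of $F_n$, then $G$ is isomorphic to $F_n$.
   Context: For a positive integer $n$, the friendship graph $F_n$ is the graph on $2n+1$ vertices consisting of $n$ edge-disjoint triangles (cycles of length $3$) all meeting in one common vertex. The adjacency spectrum of a graph is the multiset of eigenvalues of its adjacency matrix. -}

module Defs where

open import Data.Nat as ℕ using (ℕ; zero; suc; _/_; _≡ᵇ_)
open import Data.Bool using (Bool; true; false; not; _∧_; if_then_else_)
open import Data.Fin using (Fin; zero; suc; toℕ; punchIn)
open import Data.Integer as ℤ using (ℤ; +_; -_; _*_; _+_; _-_)
open import Data.Product using (Σ; _×_; _,_)
open import Function.Bundles using (_↔_; Inverse)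
open import Relation.Binary.PropositionalEquality using (_≡_; refl)

record SimpleGraph (m : ℕ) : Set where
  field
    adj   : Fin m → Fin m → Bool
    symm  : ∀ u v → adj u v ≡ adj v u
    irrfl : ∀ v → adj v v ≡ false
open SimpleGraph public

Matrix : ℕ → Set
Matrix m = Fin m → Fin m → ℤ

adjMatrix : ∀ {m} → SimpleGraph m → Matrix m
adjMatrix G u v = if adj G u v then + 1 else + 0

sign : ℕ → ℤ
sign zero = + 1
sign (suc k) = - sign k

sumFin : ∀ {m} → (Fin m → ℤ) → ℤ
sumFin {zero} f = + 0
sumFin {suc m} f = f zero + sumFin (λ i → f (suc i))

det : ∀ {m} → Matrix m → ℤ
det {zero} M = + 1
det {suc m} M = sumFin (λ j → sign (toℕ j) * (M zero j * det (λ r c → M (suc r) (punchIn j c))))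

identity : ∀ {m} → Matrix m
identity {m} u v = if toℕ u ≡ᵇ toℕ v then + 1 else + 0

charPoly : ∀ {m} → SimpleGraph m → ℤ → ℤ
charPoly G t = det (λ u v → t * identity u v - adjMatrix G u v)

-- Cospectral: equal characteristic polynomials (equivalently, equal
-- multisets of adjacency eigenvalues). Integer-coefficient polynomials
-- are equal iff they agree at every integer.
Cospectral : ∀ {m k} → SimpleGraph m → SimpleGraph k → Set
Cospectral G H = ∀ t → charPoly G t ≡ charPoly H t

data Reachable {m} (G : SimpleGraph m) : Fin m → Fin m → Set where
  here : ∀ {v} → Reachable G v v
  step : ∀ {u w v} → adj G u w ≡ true → Reachable G w v → Reachable G u v

Connected : ∀ {m} → SimpleGraph m → Set
Connected {m} G = ∀ (u v : Fin m) → Reachable G u v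

Isomorphic : ∀ {m k} → SimpleGraph m → SimpleGraph k → Set
Isomorphic {m} {k} G H =
  Σ (Fin m ↔ Fin k) λ f → ∀ u v → adj G u v ≡ adj H (Inverse.to f u) (Inverse.to f v)

-- Friendship graph F_n on Fin (2n+1) = Fin (suc (n + n)).
-- Vertex 0 is the centre; vertex (suc i), i < 2n, lies in triangle ⌊i/2⌋,
-- i.e. the triangles are {0, 2k+1, 2k+2} for k < n.
private
  ≡ᵇ-sym : ∀ a b → (a ≡ᵇ b) ≡ (b ≡ᵇ a)
  ≡ᵇ-sym zero zero = refl
  ≡ᵇ-sym zero (suc b) = refl
  ≡ᵇ-sym (suc a) zero = refl
  ≡ᵇ-sym (suc a) (suc b) = ≡ᵇ-sym a b

  ≡ᵇ-refl : ∀ a → (a ≡ᵇ a) ≡ true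
  ≡ᵇ-refl zero = refl
  ≡ᵇ-refl (suc a) = ≡ᵇ-refl a

  fadj : ∀ {n} → Fin (suc n) → Fin (suc n) → Bool
  fadj zero zero = false
  fadj zero (suc j) = true
  fadj (suc i) zero = true
  fadj (suc i) (suc j) = not (toℕ i ≡ᵇ toℕ j) ∧ ((toℕ i / 2) ≡ᵇ (toℕ j / 2))

  fsym : ∀ {n} (u v : Fin (suc n)) → fadj u v ≡ fadj v u
  fsym zero zero = refl
  fsym zero (suc j) = refl
  fsym (suc i) zero = refl
  fsym (suc i) (suc j) rewrite ≡ᵇ-sym (toℕ i) (toℕ j) | ≡ᵇ-sym (toℕ i / 2) (toℕ j / 2) = refl

  firr : ∀ {n} (v : Fin (suc n)) → fadj v v ≡ false
  firr zero = refl
  firr (suc i) rewrite ≡ᵇ-refl (toℕ i) = refl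

friendship : (n : ℕ) → SimpleGraph (suc (n ℕ.+ n))
friendship n = record { adj = fadj ; symm = fsym ; irrfl = firr }

-- Two ideas. First, equal characteristic polynomials give equal traces of all powers of the adjacency
-- matrices: tr adj (tI − A) is the derivative of the characteristic polynomial p, and
-- t tr (Aᵏ adj (tI − A)) − tr (Aᵏ⁺¹ adj (tI − A)) = p (t) tr Aᵏ, where both traces on the left have degree
-- less than that of p; so tr Aᵏ is determined by induction on k. With N = 2n and
-- f (t) = (t² − 1)(t² − t − N), which annihilates the adjacency matrix of Fₙ, it follows that G has N + 1
-- vertices and 3n edges, and that the trace of f (A)², the sum of the squares of the entries of f (A),
-- vanishes, so that f (A) = 0.
--
-- Secondly, f (A) = 0 makes B = A² − I positive semidefinite for n ≥ 2: it is an integral Gram matrix with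
-- diagonal entries degree − 1, whose off-diagonal entries count common neighbours. Two vertices of degree 2
-- are represented by unit vectors; these cannot be orthogonal, hence they coincide, so any two vertices of
-- degree 2 have exactly one common neighbour and equal rows in B. Their neighbourhoods then form a triangle
-- or a star. As Σ (degree − 3) = −3, counting rules out the triangle, and in a star with centre h it
-- forces every vertex other than h to have degree 2 if it is adjacent to h and 3 otherwise. The Gram
-- inequalities leave only the case in which all vertices are adjacent to h, which is Fₙ.

module Submission where

open import Defs
open import Data.Bool using (Bool; true; false; if_then_else_; _∧_; not)
import Data.Bool.Properties as Bool
open import Data.Empty using (⊥; ⊥-elim)
open import Data.Fin as Fin using (Fin; zero; suc; toℕ; punchIn)
open import Data.Fin.Permutation using (Permutation; permutation)
import Data.Fin.Properties as Finₚ
open import Data.Integer as ℤ using (ℤ; +_; -[1+_]; -_; _*_; _+_; _-_; ∣_∣)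
import Data.Integer.Properties as ℤ
open import Data.Integer.Tactic.RingSolver using (solve-∀)
open import Data.List using (List; []; _∷_; length)
open import Data.List.Membership.Propositional using (_∈_)
open import Data.List.Relation.Unary.All as All using (All; []; _∷_)
open import Data.List.Relation.Unary.AllPairs using ([]; _∷_)
open import Data.List.Relation.Unary.Any using (here; there)
open import Data.List.Relation.Unary.Unique.Propositional using (Unique)
open import Data.Nat as ℕ using (ℕ; zero; suc; _≤_; _/_; _≡ᵇ_)
open import Data.Nat.DivMod using (m/n≡1+[m∸n]/n)
import Data.Nat.Properties as ℕ
open import Data.Product using (∃; _×_; _,_; proj₁; proj₂)
open import Data.Sum as Sum using (_⊎_; inj₁; inj₂)
open import Data.Vec.Functional using (updateAt)
open import Data.Vec.Functional.Properties
  using (updateAt-updates; updateAt-minimal; updateAt-id-local; updateAt-commutes; map-updateAt)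
open import Function using (_∘_; const)
open import Function.Bundles using (mk↔ₛ′; Equivalence)
open import Relation.Binary.PropositionalEquality
open import Relation.Nullary using (Dec; yes; no; ¬_; ¬?; contradiction; _×-dec_)
open import Relation.Nullary.Decidable using (decidable-stable)
open import Algebra.Properties.AbelianGroup ℤ.+-0-abelianGroup using () renaming (∙-cancelˡ to +-cancelˡ)
import Algebra.Properties.Semiring.Sum ℤ.+-*-semiring as Σ

open ≡-Reasoning

-- Everything stays in ℤ: no eigenvalue is ever named. The characteristic polynomial is only a
-- function on ℤ, so its derivative is read off from expansions modulo h² and its degree from growth
-- bounds; multiplicities are replaced by traces, and positivity by the explicit identity
-- `sum-of-squares`. The quartic comes from the spectrum of Fₙ: the eigenvalues ±1, and the two
-- roots of t² - t - N, each of them simple. Passing to A² - I erases ±1, so for n ≥ 2 two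
-- orthogonal unit vectors should exhaust what is left. Without speaking of rank, this becomes a
-- count: A² - I has trace 2N - 1, each of the two vectors accounts for at least N - 1 of it, and
-- the remainder of at most 1 is too small for an integral matrix to hide in. For N = 2 the roots
-- are 2 and -1, and the positivity argument degenerates; the triangle is therefore settled by
-- counting its edges.

Vector : ℕ → Set
Vector m = Fin m → ℤ

-- Sums

sumFin≡sum : ∀ {m} (f : Vector m) → sumFin f ≡ Σ.sum f
sumFin≡sum {zero}  f = refl
sumFin≡sum {suc m} f = cong (_+_ (f zero)) (sumFin≡sum (f ∘ suc))

sumFin-cong : ∀ {m} {f g : Vector m} → (∀ i → f i ≡ g i) → sumFin f ≡ sumFin g
sumFin-cong {zero}  eq = refl
sumFin-cong {suc m} eq = cong₂ _+_ (eq zero) (sumFin-cong (eq ∘ suc))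

sumFin-zero : ∀ {m} {f : Vector m} → (∀ i → f i ≡ + 0) → sumFin f ≡ + 0
sumFin-zero {zero}  eq = refl
sumFin-zero {suc m} eq = cong₂ _+_ (eq zero) (sumFin-zero (eq ∘ suc))

sumFin-+ : ∀ {m} (f g : Vector m) → sumFin (λ i → f i + g i) ≡ sumFin f + sumFin g
sumFin-+ f g rewrite sumFin≡sum f | sumFin≡sum g =
  trans (sumFin≡sum (λ i → f i + g i)) (Σ.∑-distrib-+ f g)

sumFin-*ˡ : ∀ {m} c (f : Vector m) → sumFin (λ i → c * f i) ≡ c * sumFin f
sumFin-*ˡ c f rewrite sumFin≡sum f =
  trans (sumFin≡sum (λ i → c * f i)) (sym (Σ.*-distribˡ-sum c f))

sumFin-*ʳ : ∀ {m} (f : Vector m) c → sumFin (λ i → f i * c) ≡ sumFin f * c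
sumFin-*ʳ f c rewrite sumFin≡sum f =
  trans (sumFin≡sum (λ i → f i * c)) (sym (Σ.*-distribʳ-sum c f))

sumFin-neg : ∀ {m} (f : Vector m) → sumFin (λ i → - f i) ≡ - sumFin f
sumFin-neg f = begin
  sumFin (λ i → - f i)          ≡⟨ sumFin-cong (λ i → sym (ℤ.-1*i≡-i (f i))) ⟩
  sumFin (λ i → ℤ.-1ℤ * f i)    ≡⟨ sumFin-*ˡ ℤ.-1ℤ f ⟩
  ℤ.-1ℤ * sumFin f              ≡⟨ ℤ.-1*i≡-i (sumFin f) ⟩
  - sumFin f                    ∎

sumFin-- : ∀ {m} (f g : Vector m) → sumFin (λ i → f i - g i) ≡ sumFin f - sumFin g
sumFin-- f g = trans (sumFin-+ f (λ i → - g i)) (cong (_+_ (sumFin f)) (sumFin-neg g))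

sumFin-swap : ∀ {m n} (f : Fin m → Fin n → ℤ) →
  sumFin (λ i → sumFin (f i)) ≡ sumFin (λ j → sumFin (λ i → f i j))
sumFin-swap f = begin
  sumFin (λ i → sumFin (f i))          ≡⟨ double f ⟩
  Σ.sum (λ i → Σ.sum (f i))                ≡⟨ Σ.∑-comm f ⟩
  Σ.sum (λ j → Σ.sum (λ i → f i j))        ≡⟨ sym (double (λ j i → f i j)) ⟩
  sumFin (λ j → sumFin (λ i → f i j))  ∎
  where
  double : ∀ {m n} (f : Fin m → Fin n → ℤ) → sumFin (λ i → sumFin (f i)) ≡ Σ.sum (λ i → Σ.sum (f i))
  double f = trans (sumFin-cong (λ i → sumFin≡sum (f i))) (sumFin≡sum (λ i → Σ.sum (f i)))

sumFin-const : ∀ m c → sumFin {m} (const c) ≡ + m * c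
sumFin-const zero    c = refl
sumFin-const (suc m) c = begin
  c + sumFin {m} (const c)  ≡⟨ cong (_+_ c) (sumFin-const m c) ⟩
  c + + m * c               ≡⟨ sym (ℤ.suc-* (+ m) c) ⟩
  + suc m * c               ∎

sumFin-identity : ∀ {m} (i : Fin m) (f : Vector m) → sumFin (λ j → identity i j * f j) ≡ f i
sumFin-identity zero f = begin
  + 1 * f zero + sumFin (λ j → + 0 * f (suc j))  ≡⟨ cong (_+_ (+ 1 * f zero)) (sumFin-zero {f = λ j → + 0 * f (suc j)} λ j → refl) ⟩
  + 1 * f zero + + 0                             ≡⟨ one-term (f zero) ⟩
  f zero                                         ∎
  where
  one-term : ∀ x → + 1 * x + + 0 ≡ x
  one-term = solve-∀
sumFin-identity (suc i) f = begin
  + 0 + sumFin (λ j → identity i j * f (suc j))  ≡⟨ ℤ.+-identityˡ _ ⟩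
  sumFin (λ j → identity i j * f (suc j))        ≡⟨ sumFin-identity i (f ∘ suc) ⟩
  f (suc i)                                      ∎

identity-sym : ∀ {m} (i j : Fin m) → identity i j ≡ identity j i
identity-sym zero    zero    = refl
identity-sym zero    (suc j) = refl
identity-sym (suc i) zero    = refl
identity-sym (suc i) (suc j) = identity-sym i j

identity-diag : ∀ {m} (i : Fin m) → identity i i ≡ + 1
identity-diag zero    = refl
identity-diag (suc i) = identity-diag i

identity-off : ∀ {m} {i j : Fin m} → i ≢ j → identity i j ≡ + 0
identity-off {i = zero}  {zero}  i≢j = contradiction refl i≢j
identity-off {i = zero}  {suc j} i≢j = refl
identity-off {i = suc i} {zero}  i≢j = refl
identity-off {i = suc i} {suc j} i≢j = identity-off (i≢j ∘ cong suc)

-- Determinants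

minor : ∀ {m} → Matrix (suc m) → Fin (suc m) → Matrix m
minor M j r c = M (suc r) (punchIn j c)

setRow : ∀ {m} → Matrix m → Fin m → Vector m → Matrix m
setRow M i r = updateAt M i (const r)

det-cong : ∀ {m} {M N : Matrix m} → (∀ i j → M i j ≡ N i j) → det M ≡ det N
det-cong {zero}  eq = refl
det-cong {suc m} eq = sumFin-cong λ j → cong (sign (toℕ j) *_)
  (cong₂ _*_ (eq zero j) (det-cong λ r c → eq (suc r) (punchIn j c)))

minor-setRow : ∀ {m} (M : Matrix (suc m)) i r j a c →
  minor (setRow M (suc i) r) j a c ≡ setRow (minor M j) i (r ∘ punchIn j) a c
minor-setRow M i r j a = cong-app (map-updateAt {f = _∘ punchIn j} (λ _ → refl) (M ∘ suc) i a)

det-setRow-suc : ∀ {m} (M : Matrix (suc m)) i r →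
  det (setRow M (suc i) r) ≡
  sumFin (λ j → sign (toℕ j) * (M zero j * det (setRow (minor M j) i (r ∘ punchIn j))))
det-setRow-suc M i r = sumFin-cong λ j →
  cong (λ d → sign (toℕ j) * (M zero j * d)) (det-cong (minor-setRow M i r j))

det-setRow-cong : ∀ {m} (M : Matrix m) i {r s : Vector m} → (∀ c → r c ≡ s c) →
  det (setRow M i r) ≡ det (setRow M i s)
det-setRow-cong M i {r} {s} eq = det-cong (rows M i)
  where
  rows : ∀ {n} (M : Fin n → Vector _) i a c →
    updateAt M i (const r) a c ≡ updateAt M i (const s) a c
  rows M zero    zero    c = eq c
  rows M zero    (suc a) c = refl
  rows M (suc i) zero    c = refl
  rows M (suc i) (suc a) c = rows (M ∘ suc) i a c

det-setRow-id : ∀ {m} (M : Matrix m) i {r : Vector m} → (∀ c → M i c ≡ r c) →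
  det (setRow M i r) ≡ det M
det-setRow-id M i {r} eq = trans (det-setRow-cong M i (sym ∘ eq))
  (det-cong λ a → cong-app (updateAt-id-local i M refl a))

-- The combination may have any length because `adjugateTrace-step` inserts a combination of all
-- rows of a matrix at once.
det-setRow-linear : ∀ {k m} (M : Matrix m) i (a : Vector k) (R : Fin k → Vector m) →
  det (setRow M i (λ c → sumFin (λ w → a w * R w c))) ≡ sumFin (λ w → a w * det (setRow M i (R w)))
det-setRow-linear M zero a R = begin
  sumFin (λ j → sign (toℕ j) * (sumFin (λ w → a w * R w j) * det (minor M j)))
    ≡⟨ sumFin-cong (λ j → pull-out (sign (toℕ j)) (λ w → a w * R w j) (det (minor M j))) ⟩
  sumFin (λ j → sumFin (λ w → sign (toℕ j) * (a w * R w j * det (minor M j))))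
    ≡⟨ sumFin-swap (λ j w → sign (toℕ j) * (a w * R w j * det (minor M j))) ⟩
  sumFin (λ w → sumFin (λ j → sign (toℕ j) * (a w * R w j * det (minor M j))))
    ≡⟨ sumFin-cong (λ w → trans
         (sumFin-cong λ j → rearrange (sign (toℕ j)) (a w) (R w j) (det (minor M j)))
         (sumFin-*ˡ (a w) (λ j → sign (toℕ j) * (R w j * det (minor M j))))) ⟩
  sumFin (λ w → a w * det (setRow M zero (R w)))  ∎
  where
  rearrange : ∀ s a r d → s * (a * r * d) ≡ a * (s * (r * d))
  rearrange = solve-∀
  pull-out : ∀ {k} s (f : Vector k) d → s * (sumFin f * d) ≡ sumFin (λ w → s * (f w * d))
  pull-out s f d = trans (cong (s *_) (sym (sumFin-*ʳ f d))) (sym (sumFin-*ˡ s (λ w → f w * d)))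
det-setRow-linear M (suc i) a R = begin
  det (setRow M (suc i) (λ c → sumFin (λ w → a w * R w c)))
    ≡⟨ det-setRow-suc M i _ ⟩
  sumFin (λ j → s j * (M zero j * det (setRow (minor M j) i (λ c → sumFin (λ w → a w * R w (punchIn j c))))))
    ≡⟨ sumFin-cong (λ j → cong (λ d → s j * (M zero j * d)) (det-setRow-linear (minor M j) i a (λ w c → R w (punchIn j c)))) ⟩
  sumFin (λ j → s j * (M zero j * sumFin (λ w → a w * D j w)))
    ≡⟨ sumFin-cong (λ j → pull-out (s j) (M zero j) (λ w → a w * D j w)) ⟩
  sumFin (λ j → sumFin (λ w → s j * (M zero j * (a w * D j w))))
    ≡⟨ sumFin-swap (λ j w → s j * (M zero j * (a w * D j w))) ⟩
  sumFin (λ w → sumFin (λ j → s j * (M zero j * (a w * D j w))))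
    ≡⟨ sumFin-cong (λ w → trans
         (sumFin-cong λ j → rearrange (s j) (M zero j) (a w) (D j w))
         (trans (sumFin-*ˡ (a w) (λ j → s j * (M zero j * D j w))) (cong (a w *_) (sym (det-setRow-suc M i (R w)))))) ⟩
  sumFin (λ w → a w * det (setRow M (suc i) (R w)))  ∎
  where
  s : Vector _
  s j = sign (toℕ j)
  D : ∀ j → Vector _
  D j w = det (setRow (minor M j) i (λ c → R w (punchIn j c)))
  rearrange : ∀ s x a d → s * (x * (a * d)) ≡ a * (s * (x * d))
  rearrange = solve-∀
  pull-out : ∀ {k} s x (f : Vector k) → s * (x * sumFin f) ≡ sumFin (λ w → s * (x * f w))
  pull-out s x f = trans (cong (s *_) (sym (sumFin-*ˡ x f))) (sym (sumFin-*ˡ s (λ w → x * f w)))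

det-setRow-combine : ∀ {m} (M : Matrix m) i a b (r s : Vector m) →
  det (setRow M i (λ c → a * r c + b * s c)) ≡ a * det (setRow M i r) + b * det (setRow M i s)
det-setRow-combine {m} M i a b r s = begin
  det (setRow M i (λ c → a * r c + b * s c))
    ≡⟨ det-setRow-cong M i (λ c → cong (_+_ (a * r c)) (sym (ℤ.+-identityʳ (b * s c)))) ⟩
  det (setRow M i (λ c → sumFin (λ w → coeff w * row w c)))
    ≡⟨ det-setRow-linear M i coeff row ⟩
  a * det (setRow M i r) + (b * det (setRow M i s) + + 0)
    ≡⟨ cong (_+_ (a * det (setRow M i r))) (ℤ.+-identityʳ _) ⟩
  a * det (setRow M i r) + b * det (setRow M i s) ∎
  where
  coeff : Vector 2
  coeff zero    = a
  coeff (suc _) = b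
  row : Fin 2 → Vector m
  row zero    = r
  row (suc _) = s

-- The terms (j , l) and (l , j) of the double Laplace expansion along two equal rows cancel; the
-- induction peels off the terms that involve the first column.
double-expansion : ∀ {m} (a : Vector (suc (suc m))) (D : (Fin m → Fin (suc (suc m))) → ℤ) →
  (∀ {g h} → (∀ r → g r ≡ h r) → D g ≡ D h) →
  sumFin (λ j → sign (toℕ j) * (a j * sumFin (λ l →
    sign (toℕ l) * (a (punchIn j l) * D (λ r → punchIn j (punchIn l r)))))) ≡ + 0
double-expansion {m} a D D-cong = begin
  -- `first` gathers the pairs with j = 0, the terms with `E j` those with l = 0; they carry
  -- opposite signs.
  + 1 * (a zero * first) + sumFin (λ j → - s j * (a (suc j) * (+ 1 * (a zero * E j) + rest j)))
    ≡⟨ cong (_+_ (+ 1 * (a zero * first))) (sumFin-cong λ j → split (s j) (a (suc j)) (a zero) (E j) (rest j)) ⟩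
  + 1 * (a zero * first) + sumFin (λ j → - (a zero) * (s j * (a (suc j) * E j)) + - (s j * (a (suc j) * rest j)))
    ≡⟨ cong (_+_ (+ 1 * (a zero * first))) (trans
         (sumFin-+ (λ j → - (a zero) * (s j * (a (suc j) * E j))) (λ j → - (s j * (a (suc j) * rest j))))
         (cong₂ _+_ (sumFin-*ˡ (- (a zero)) (λ j → s j * (a (suc j) * E j))) (tail-cancels m a D D-cong))) ⟩
  + 1 * (a zero * first) + (- (a zero) * first + + 0)
    ≡⟨ cancel (a zero) first ⟩
  + 0 ∎
  where
  s : ∀ {k} → Vector k
  s j = sign (toℕ j)
  E : Vector (suc m)
  E j = D (λ r → suc (punchIn j r))
  first : ℤ
  first = sumFin (λ l → s l * (a (suc l) * E l))
  rest : Vector (suc m)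
  rest j = sumFin (λ l → - s l * (a (suc (punchIn j l)) * D (λ r → punchIn (suc j) (punchIn (suc l) r))))
  split : ∀ s x y e q → - s * (x * (+ 1 * (y * e) + q)) ≡ - y * (s * (x * e)) + - (s * (x * q))
  split = solve-∀
  cancel : ∀ x f → + 1 * (x * f) + (- x * f + + 0) ≡ + 0
  cancel = solve-∀
  tail-cancels : ∀ m (a : Vector (suc (suc m))) (D : (Fin m → Fin (suc (suc m))) → ℤ) →
    (∀ {g h} → (∀ r → g r ≡ h r) → D g ≡ D h) →
    sumFin (λ j → - (s j * (a (suc j) * sumFin (λ l →
      - s l * (a (suc (punchIn j l)) * D (λ r → punchIn (suc j) (punchIn (suc l) r))))))) ≡ + 0
  tail-cancels zero a D D-cong = zero-sum (a (suc zero))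
    where
    zero-sum : ∀ x → - (+ 1 * (x * + 0)) + + 0 ≡ + 0
    zero-sum = solve-∀
  tail-cancels (suc m) a D D-cong = begin
    sumFin (λ j → - (s j * (a (suc j) * sumFin (λ l →
      - s l * (a (suc (punchIn j l)) * D (λ r → punchIn (suc j) (punchIn (suc l) r)))))))
      ≡⟨ sumFin-cong (λ j → trans (cong (λ x → - (s j * (a (suc j) * x)))
           (trans (sumFin-cong λ l → trans
             (cong (λ d → - s l * (a (suc (punchIn j l)) * d)) (D-cong (lift-punchIn j l)))
             (sym (ℤ.neg-distribˡ-* (s l) (a (suc (punchIn j l)) * D (Fin.lift 1 (λ r → punchIn j (punchIn l r)))))))
           (sumFin-neg (lower j)))) (double-neg (s j) (a (suc j)) (sumFin (lower j)))) ⟩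
    sumFin (λ j → s j * (a (suc j) * sumFin (λ l →
      s l * (a (suc (punchIn j l)) * D (Fin.lift 1 (λ r → punchIn j (punchIn l r)))))))
      ≡⟨ double-expansion (a ∘ suc) (λ g → D (Fin.lift 1 g)) (λ eq → D-cong (lift-cong eq)) ⟩
    + 0 ∎
    where
    lower : Fin (suc (suc m)) → Vector (suc m)
    lower j l = s l * (a (suc (punchIn j l)) * D (Fin.lift 1 (λ r → punchIn j (punchIn l r))))
    double-neg : ∀ s x y → - (s * (x * - y)) ≡ s * (x * y)
    double-neg = solve-∀
    lift-cong : ∀ {k n} {g h : Fin k → Fin n} → (∀ r → g r ≡ h r) → ∀ r → Fin.lift 1 g r ≡ Fin.lift 1 h r
    lift-cong eq zero    = refl
    lift-cong eq (suc r) = cong suc (eq r)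
    lift-punchIn : ∀ (j : Fin (suc (suc m))) l r →
      punchIn (suc j) (punchIn (suc l) r) ≡ Fin.lift 1 (λ r → punchIn j (punchIn l r)) r
    lift-punchIn j l zero    = refl
    lift-punchIn j l (suc r) = refl

det-equal-top-rows : ∀ {m} (M : Matrix (suc (suc m))) → (∀ c → M zero c ≡ M (suc zero) c) → det M ≡ + 0
det-equal-top-rows M eq = trans
  (sumFin-cong λ j → cong (λ x → sign (toℕ j) * (M zero j * x)) (sumFin-cong λ l →
    cong (λ y → sign (toℕ l) * (y * det (minor (minor M j) l))) (sym (eq (punchIn j l)))))
  (double-expansion (M zero) (λ g → det (λ r c → M (suc (suc r)) (g c)))
    λ g≗h → det-cong λ r c → cong (M (suc (suc r))) (g≗h c))

-- With r the common row and a row number 1, expand det (r , a + r , … , a + r) = 0: every term but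
-- det (r , a , … , r) has equal rows 0 and 1 or equal rows 1 and k + 2.
det-equal-far-rows : ∀ {m} (M : Matrix (suc (suc m))) k →
  (∀ N → (∀ c → N (suc zero) c ≡ N (suc (suc k)) c) → det N ≡ + 0) →
  (∀ c → M zero c ≡ M (suc (suc k)) c) → det M ≡ + 0
det-equal-far-rows {m} M k lower eq = begin
  det M                           ≡⟨ sym (det-setRow-id M (suc zero) (λ c → refl)) ⟩
  φ a                             ≡⟨ expand (φ a) ⟩
  + 1 * φ a + + 1 * + 0           ≡⟨ cong (λ x → + 1 * φ a + + 1 * x) (sym φr) ⟩
  + 1 * φ a + + 1 * φ r           ≡⟨ sym (det-setRow-combine M (suc zero) (+ 1) (+ 1) a r) ⟩
  φ a+r                           ≡⟨ sym (det-setRow-id (setRow M (suc zero) a+r) (suc (suc k)) (sym ∘ eq)) ⟩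
  ψ r                             ≡⟨ expand′ (ψ r) ⟩
  + 1 * + 0 + + 1 * ψ r           ≡⟨ cong (λ x → + 1 * x + + 1 * ψ r) (sym ψa) ⟩
  + 1 * ψ a + + 1 * ψ r           ≡⟨ sym (det-setRow-combine (setRow M (suc zero) a+r) (suc (suc k)) (+ 1) (+ 1) a r) ⟩
  ψ a+r                           ≡⟨ lower (setRow (setRow M (suc zero) a+r) (suc (suc k)) a+r)
                                       (λ c → sym (cong-app (updateAt-updates (suc (suc k)) (setRow M (suc zero) a+r)) c)) ⟩
  + 0                             ∎
  where
  r a a+r : Vector (suc (suc m))
  r = M zero
  a = M (suc zero)
  a+r c = + 1 * a c + + 1 * r c
  φ ψ χ : Vector (suc (suc m)) → ℤ
  φ x = det (setRow M (suc zero) x)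
  ψ x = det (setRow (setRow M (suc zero) a+r) (suc (suc k)) x)
  χ x = det (setRow (setRow M (suc (suc k)) a) (suc zero) x)
  expand : ∀ x → x ≡ + 1 * x + + 1 * + 0
  expand = solve-∀
  expand′ : ∀ x → x ≡ + 1 * + 0 + + 1 * x
  expand′ = solve-∀
  φr : φ r ≡ + 0
  φr = det-equal-top-rows (setRow M (suc zero) r) (λ c → refl)
  χr : χ r ≡ + 0
  χr = det-equal-top-rows (setRow (setRow M (suc (suc k)) a) (suc zero) r) (λ c → refl)
  χa : χ a ≡ + 0
  χa = lower (setRow (setRow M (suc (suc k)) a) (suc zero) a)
    (λ c → sym (cong-app (updateAt-updates k (λ x → M (suc (suc x)))) c))
  ψa : ψ a ≡ + 0
  ψa = begin
    ψ a                     ≡⟨ det-cong (λ x → cong-app (updateAt-commutes (suc (suc k)) (suc zero) {const a} {const a+r} (λ ()) M x)) ⟩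
    χ a+r                   ≡⟨ det-setRow-combine (setRow M (suc (suc k)) a) (suc zero) (+ 1) (+ 1) a r ⟩
    + 1 * χ a + + 1 * χ r   ≡⟨ cong₂ (λ x y → + 1 * x + + 1 * y) χa χr ⟩
    + 0                     ∎

-- `det` expands along row 0 only. Two lower rows stay equal in every minor; a pair that includes
-- row 0 needs `det-equal-top-rows` or `det-equal-far-rows`.
det-equal-rows : ∀ {m} (M : Matrix m) i k → i ≢ k → (∀ c → M i c ≡ M k c) → det M ≡ + 0

det-equal-lower-rows : ∀ {m} (M : Matrix (suc m)) i k → i ≢ k →
  (∀ c → M (suc i) c ≡ M (suc k) c) → det M ≡ + 0
det-equal-lower-rows M i k i≢k eq = sumFin-zero λ j → trans
  (cong (λ d → sign (toℕ j) * (M zero j * d)) (det-equal-rows (minor M j) i k i≢k (eq ∘ punchIn j)))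
  (trans (cong (sign (toℕ j) *_) (ℤ.*-zeroʳ (M zero j))) (ℤ.*-zeroʳ (sign (toℕ j))))

det-equal-rows M zero zero i≢k eq = contradiction refl i≢k
det-equal-rows M (suc i) (suc k) i≢k eq = det-equal-lower-rows M i k (i≢k ∘ cong suc) eq
det-equal-rows {suc (suc m)} M zero (suc zero) i≢k eq = det-equal-top-rows M eq
det-equal-rows {suc (suc m)} M zero (suc (suc k)) i≢k eq =
  det-equal-far-rows M k (λ N → det-equal-lower-rows N zero (suc k) (λ ())) eq
det-equal-rows {suc (suc m)} M (suc zero) zero i≢k eq = det-equal-top-rows M (sym ∘ eq)
det-equal-rows {suc (suc m)} M (suc (suc k)) zero i≢k eq =
  det-equal-far-rows M k (λ N → det-equal-lower-rows N zero (suc k) (λ ())) (sym ∘ eq)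

-- Derivatives of integer functions

-- For polynomial functions over ℤ this first-order expansion modulo h² pins down the derivative,
-- since h may be taken larger than any given integer.
record HasDerivative (f f′ : ℤ → ℤ) : Set where
  constructor derivative
  field
    expansion : ∀ t h → ∃ λ q → f (t + h) ≡ f t + h * f′ t + h * h * q

derivative-cong : ∀ {f f′ g′} → (∀ t → f′ t ≡ g′ t) → HasDerivative f f′ → HasDerivative f g′
derivative-cong {f} eq (derivative df) = derivative λ t h →
  let q , e = df t h in q , trans e (cong (λ x → f t + h * x + h * h * q) (eq t))

derivative-const : ∀ c → HasDerivative (const c) (const (+ 0))
derivative-const c = derivative λ t h → + 0 , expand c h
  where
  expand : ∀ c h → c ≡ c + h * + 0 + h * h * + 0
  expand = solve-∀

derivative-+ : ∀ {f f′ g g′} → HasDerivative f f′ → HasDerivative g g′ →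
  HasDerivative (λ t → f t + g t) (λ t → f′ t + g′ t)
derivative-+ {f} {f′} {g} {g′} (derivative df) (derivative dg) = derivative λ t h →
  let q , e = df t h ; r , e′ = dg t h in
  q + r , trans (cong₂ _+_ e e′) (regroup (f t) (f′ t) (g t) (g′ t) h q r)
  where
  regroup : ∀ f f′ g g′ h q r →
    f + h * f′ + h * h * q + (g + h * g′ + h * h * r) ≡ f + g + h * (f′ + g′) + h * h * (q + r)
  regroup = solve-∀

derivative-* : ∀ {f f′ g g′} → HasDerivative f f′ → HasDerivative g g′ →
  HasDerivative (λ t → f t * g t) (λ t → f′ t * g t + f t * g′ t)
derivative-* {f} {f′} {g} {g′} (derivative df) (derivative dg) = derivative λ t h →
  let q , e = df t h ; r , e′ = dg t h in
  f′ t * g′ t + f t * r + q * g t + h * (f′ t * r + q * g′ t) + h * h * (q * r) ,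
  trans (cong₂ _*_ e e′) (regroup (f t) (f′ t) (g t) (g′ t) h q r)
  where
  regroup : ∀ f f′ g g′ h q r → (f + h * f′ + h * h * q) * (g + h * g′ + h * h * r) ≡
    f * g + h * (f′ * g + f * g′) + h * h * (f′ * g′ + f * r + q * g + h * (f′ * r + q * g′) + h * h * (q * r))
  regroup = solve-∀

derivative-sumFin : ∀ {m} {f f′ : Fin m → ℤ → ℤ} → (∀ i → HasDerivative (f i) (f′ i)) →
  HasDerivative (λ t → sumFin (λ i → f i t)) (λ t → sumFin (λ i → f′ i t))
derivative-sumFin {zero}  df = derivative-const (+ 0)
derivative-sumFin {suc m} df = derivative-+ (df zero) (derivative-sumFin (df ∘ suc))

-- For h = 1 + ∣f′ t - g′ t∣ the two expansions give f′ t - g′ t = h (r - q), a multiple of h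
-- smaller than h in absolute value.
derivative-unique : ∀ {f f′ g g′} → (∀ t → f t ≡ g t) → HasDerivative f f′ → HasDerivative g g′ →
  ∀ t → f′ t ≡ g′ t
derivative-unique {f} {f′} {g} {g′} f≗g (derivative df) (derivative dg) t with df t h | dg t h
  where
  h : ℤ
  h = + suc ∣ f′ t - g′ t ∣
... | q , e | r , e′ = ℤ.i-j≡0⇒i≡j (f′ t) (g′ t) (ℤ.∣i∣≡0⇒i≡0 (vanish ∣ f′ t - g′ t ∣ ∣ r - q ∣ bound))
  where
  h : ℤ
  h = + suc ∣ f′ t - g′ t ∣
  subtract : ∀ f a b h q r → f + h * a + h * h * q ≡ f + h * b + h * h * r → h * (a - b) ≡ h * (h * (r - q))
  subtract f a b h q r eq = begin
    h * (a - b)                                                     ≡⟨ lhs f a b h q r ⟩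
    (f + h * a + h * h * q) - (f + h * b + h * h * q)               ≡⟨ cong (_- (f + h * b + h * h * q)) eq ⟩
    (f + h * b + h * h * r) - (f + h * b + h * h * q)               ≡⟨ rhs f a b h q r ⟩
    h * (h * (r - q))                                               ∎
    where
    lhs : ∀ f a b h q r → h * (a - b) ≡ (f + h * a + h * h * q) - (f + h * b + h * h * q)
    lhs = solve-∀
    rhs : ∀ f a b h q r → (f + h * b + h * h * r) - (f + h * b + h * h * q) ≡ h * (h * (r - q))
    rhs = solve-∀
  bound : ∣ f′ t - g′ t ∣ ≡ suc ∣ f′ t - g′ t ∣ ℕ.* ∣ r - q ∣
  bound = trans
    (cong ∣_∣ (ℤ.*-cancelˡ-≡ h (f′ t - g′ t) (h * (r - q)) (subtract (f t) (f′ t) (g′ t) h q r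
      (trans (sym e) (trans (f≗g (t + h)) (trans e′ (cong (λ x → x + h * g′ t + h * h * r) (sym (f≗g t)))))))))
    (ℤ.abs-* h (r - q))
  vanish : ∀ d x → d ≡ suc d ℕ.* x → d ≡ 0
  vanish d zero    eq = trans eq (ℕ.*-zeroʳ (suc d))
  vanish d (suc x) eq = contradiction (ℕ.≤-trans (ℕ.m≤m*n (suc d) (suc x)) (ℕ.≤-reflexive (sym eq))) ℕ.1+n≰n

derivative-det : ∀ {m} {M M′ : ℤ → Matrix m} →
  (∀ i j → HasDerivative (λ t → M t i j) (λ t → M′ t i j)) →
  HasDerivative (λ t → det (M t)) (λ t → sumFin (λ i → det (setRow (M t) i (M′ t i))))
derivative-det {zero} dM = derivative-const (+ 1)
derivative-det {suc m} {M} {M′} dM = derivative-cong collect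
  (derivative-sumFin λ j → derivative-* (derivative-const (s j))
    (derivative-* (dM zero j) (derivative-det λ r c → dM (suc r) (punchIn j c))))
  where
  s : Vector (suc m)
  s j = sign (toℕ j)
  E : ∀ t → Fin (suc m) → Vector m
  E t j i = det (setRow (minor (M t) j) i (minor (M′ t) j i))
  product-rule : ∀ s x x′ d e → + 0 * (x * d) + s * (x′ * d + x * e) ≡ s * (x′ * d) + s * (x * e)
  product-rule = solve-∀
  collect : ∀ t → sumFin (λ j → + 0 * (M t zero j * det (minor (M t) j)) +
      s j * (M′ t zero j * det (minor (M t) j) + M t zero j * sumFin (E t j)))
    ≡ sumFin (λ i → det (setRow (M t) i (M′ t i)))
  collect t = begin
    sumFin (λ j → + 0 * (M t zero j * D j) + s j * (M′ t zero j * D j + M t zero j * sumFin (E t j)))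
      ≡⟨ sumFin-cong (λ j → trans (product-rule (s j) (M t zero j) (M′ t zero j) (D j) (sumFin (E t j)))
           (cong (_+_ (s j * (M′ t zero j * D j))) (trans
             (cong (s j *_) (sym (sumFin-*ˡ (M t zero j) (E t j))))
             (sym (sumFin-*ˡ (s j) (λ i → M t zero j * E t j i)))))) ⟩
    sumFin (λ j → s j * (M′ t zero j * D j) + sumFin (λ i → s j * (M t zero j * E t j i)))
      ≡⟨ sumFin-+ (λ j → s j * (M′ t zero j * D j)) (λ j → sumFin (λ i → s j * (M t zero j * E t j i))) ⟩
    det (setRow (M t) zero (M′ t zero)) + sumFin (λ j → sumFin (λ i → s j * (M t zero j * E t j i)))
      ≡⟨ cong (_+_ (det (setRow (M t) zero (M′ t zero)))) (trans
           (sumFin-swap (λ j i → s j * (M t zero j * E t j i)))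
           (sumFin-cong λ i → sym (det-setRow-suc (M t) i (M′ t (suc i))))) ⟩
    sumFin (λ i → det (setRow (M t) i (M′ t i))) ∎
    where
    D : Vector (suc m)
    D j = det (minor (M t) j)

-- Growth at +∞

-- Only positive arguments enter, where the powers do not decrease with d; they are enough to detect
-- a leading coefficient.
record O (d : ℕ) (f : ℤ → ℤ) : Set where
  constructor _,_
  field
    factor : ℕ
    bound  : ∀ s → ∣ f (+ suc s) ∣ ℕ.≤ factor ℕ.* suc s ℕ.^ d

-- For polynomial functions this is O (d − 1), but it makes sense at d = 0 as well.
record Below (d : ℕ) (f : ℤ → ℤ) : Set where
  constructor below
  field
    scaled : O d (λ t → t * f t)

O-cong : ∀ {d f g} → (∀ t → f t ≡ g t) → O d f → O d g
O-cong {d} eq (C , bound) = C , λ s → subst (λ x → ∣ x ∣ ℕ.≤ C ℕ.* suc s ℕ.^ d) (eq (+ suc s)) (bound s)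

O-const : ∀ c → O 0 (const c)
O-const c = ∣ c ∣ , λ s → ℕ.≤-reflexive (sym (ℕ.*-identityʳ ∣ c ∣))

O-id : O 1 (λ t → t)
O-id = 1 , λ s → ℕ.≤-reflexive (sym (trans (ℕ.*-identityˡ (suc s ℕ.^ 1)) (ℕ.*-identityʳ (suc s))))

O-+ : ∀ {d f g} → O d f → O d g → O d (λ t → f t + g t)
O-+ {d} {f} {g} (C , b) (C′ , b′) = C ℕ.+ C′ , λ s → ℕ.≤-trans (ℤ.∣i+j∣≤∣i∣+∣j∣ (f (+ suc s)) (g (+ suc s)))
  (ℕ.≤-trans (ℕ.+-mono-≤ (b s) (b′ s)) (ℕ.≤-reflexive (sym (ℕ.*-distribʳ-+ (suc s ℕ.^ d) C C′))))

O-* : ∀ {d e f g} → O d f → O e g → O (d ℕ.+ e) (λ t → f t * g t)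
O-* {d} {e} {f} {g} (C , b) (C′ , b′) = C ℕ.* C′ , λ s → begin-≤ s
  where
  begin-≤ : ∀ s → ∣ f (+ suc s) * g (+ suc s) ∣ ℕ.≤ C ℕ.* C′ ℕ.* suc s ℕ.^ (d ℕ.+ e)
  begin-≤ s rewrite ℤ.abs-* (f (+ suc s)) (g (+ suc s)) | ℕ.^-distribˡ-+-* (suc s) d e =
    ℕ.≤-trans (ℕ.*-mono-≤ (b s) (b′ s))
      (ℕ.≤-reflexive (ℕ.[m*n]*[o*p]≡[m*o]*[n*p] C (suc s ℕ.^ d) C′ (suc s ℕ.^ e)))

O-mono : ∀ {d e f} → d ℕ.≤ e → O d f → O e f
O-mono d≤e (C , b) = C , λ s → ℕ.≤-trans (b s) (ℕ.*-monoʳ-≤ C (ℕ.^-monoʳ-≤ (suc s) d≤e))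

O-sumFin : ∀ {d m} {f : Fin m → ℤ → ℤ} → (∀ i → O d (f i)) → O d (λ t → sumFin (λ i → f i t))
O-sumFin {m = zero}  b = O-mono ℕ.z≤n (O-const (+ 0))
O-sumFin {m = suc m} b = O-+ (b zero) (O-sumFin (b ∘ suc))

O-^ : ∀ d → O d (ℤ._^ d)
O-^ zero    = O-const (+ 1)
O-^ (suc d) = O-* O-id (O-^ d)

O⇒Below : ∀ {d f} → O d f → Below (suc d) f
O⇒Below b = below (O-* O-id b)

Below-cong : ∀ {d f g} → (∀ t → f t ≡ g t) → Below d f → Below d g
Below-cong eq (below b) = below (O-cong (λ t → cong (t *_) (eq t)) b)

Below-+ : ∀ {d f g} → Below d f → Below d g → Below d (λ t → f t + g t)
Below-+ {d} {f} {g} (below bf) (below bg) = below (O-cong (λ t → sym (ℤ.*-distribˡ-+ t (f t) (g t))) (O-+ bf bg))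

Below-*ˡ : ∀ {d e f g} → O d f → Below e g → Below (d ℕ.+ e) (λ t → f t * g t)
Below-*ˡ {f = f} {g} bf (below bg) = below (O-cong (λ t → exchange (f t) t (g t)) (O-* bf bg))
  where
  exchange : ∀ x t y → x * (t * y) ≡ t * (x * y)
  exchange = solve-∀

Below-- : ∀ {d f g} → Below d f → Below d g → Below d (λ t → f t - g t)
Below-- {d} {f} {g} bf bg = Below-cong (λ t → cong (_+_ (f t)) (ℤ.-1*i≡-i (g t)))
  (Below-+ bf (Below-*ˡ (O-const ℤ.-1ℤ) bg))

Below-sumFin : ∀ {d m} {f : Fin m → ℤ → ℤ} → (∀ i → Below d (f i)) → Below d (λ t → sumFin (λ i → f i t))
Below-sumFin {f = f} b = below (O-cong (λ t → sumFin-*ˡ t (λ i → f i t)) (O-sumFin (Below.scaled ∘ b)))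

-- At t = C + 1 the bound reads ∣c∣ (C + 1) (C + 1)ᵈ ≤ C (C + 1)ᵈ.
Below-power : ∀ {d} c → Below d (λ t → c * t ℤ.^ d) → c ≡ + 0
Below-power {d} c (below (C , bound)) = ℤ.∣i∣≡0⇒i≡0 (small ∣ c ∣ (ℕ.*-cancelʳ-≤ (∣ c ∣ ℕ.* suc C) C (suc C ℕ.^ d) ⦃ ℕ.m^n≢0 (suc C) d ⦄
  (ℕ.≤-trans (ℕ.≤-reflexive rearranged) (bound C))))
  where
  abs-^ : ∀ t e → ∣ t ℤ.^ e ∣ ≡ ∣ t ∣ ℕ.^ e
  abs-^ t zero    = refl
  abs-^ t (suc e) = trans (ℤ.abs-* t (t ℤ.^ e)) (cong (∣ t ∣ ℕ.*_) (abs-^ t e))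
  rearranged : ∣ c ∣ ℕ.* suc C ℕ.* suc C ℕ.^ d ≡ ∣ + suc C * (c * (+ suc C) ℤ.^ d) ∣
  rearranged rewrite ℤ.abs-* (+ suc C) (c * (+ suc C) ℤ.^ d) | ℤ.abs-* c ((+ suc C) ℤ.^ d) | abs-^ (+ suc C) d =
    trans (cong (ℕ._* suc C ℕ.^ d) (ℕ.*-comm ∣ c ∣ (suc C))) (ℕ.*-assoc (suc C) ∣ c ∣ (suc C ℕ.^ d))
  small : ∀ x → x ℕ.* suc C ℕ.≤ C → x ≡ 0
  small zero    _ = refl
  small (suc x) h = contradiction (ℕ.≤-trans (ℕ.m≤m+n (suc C) (x ℕ.* suc C)) h) ℕ.1+n≰n

det-O : ∀ {m} {M : ℤ → Matrix m} → (∀ i j → O 1 (λ t → M t i j)) → O m (λ t → det (M t))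
det-O {zero}  b = O-const (+ 1)
det-O {suc m} b = O-sumFin λ j → O-* (O-const (sign (toℕ j)))
  (O-* (b zero j) (det-O λ r c → b (suc r) (punchIn j c)))

-- A constant row contributes no factor t, which costs one degree.
det-setRow-Below : ∀ {m} {M : ℤ → Matrix m} → (∀ i j → O 1 (λ t → M t i j)) →
  ∀ i (r : Vector m) → Below m (λ t → det (setRow (M t) i r))
det-setRow-Below {suc m} b zero r = O⇒Below (O-sumFin λ j →
  O-* (O-const (sign (toℕ j))) (O-* (O-const (r j)) (det-O λ a c → b (suc a) (punchIn j c))))
det-setRow-Below {suc m} {M} b (suc i) r = Below-cong (λ t → sym (det-setRow-suc (M t) i r))
  (Below-sumFin λ j → Below-*ˡ (O-const (sign (toℕ j)))
    (Below-*ˡ (b zero j) (det-setRow-Below (λ a c → b (suc a) (punchIn j c)) i (r ∘ punchIn j))))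

-- The characteristic polynomial and the traces of powers

charMatrix : ∀ {m} → Matrix m → ℤ → Matrix m
charMatrix A t u v = t * identity u v - A u v

charMatrix-O : ∀ {m} (A : Matrix m) i j → O 1 (λ t → charMatrix A t i j)
charMatrix-O A i j = O-+ (O-* O-id (O-const (identity i j))) (O-mono ℕ.z≤n (O-const (- A i j)))

-- In the expansion along row 0 only the diagonal entry contains t. The other terms are constants
-- times minors, for which the crude bound `det-O` is already one degree short.
charMatrix-monic : ∀ {m} (A : Matrix m) → Below m (λ t → det (charMatrix A t) - t ℤ.^ m)
charMatrix-monic {zero} A = below (O-cong (λ t → sym (ℤ.*-zeroʳ t)) (O-const (+ 0)))
charMatrix-monic {suc m} A = Below-cong (λ t → sym (expand t (A zero zero) (D t) (t ℤ.^ m) (rest t)))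
  (Below-+
    (Below-*ˡ (charMatrix-O A zero zero) (charMatrix-monic (λ r c → A (suc r) (suc c))))
    (O⇒Below (O-+
      (O-* (O-const (- A zero zero)) (O-^ m))
      (O-sumFin λ j → O-* (O-const (- sign (toℕ j))) (O-*
        (O-cong (λ t → sym (zero-coefficient t (A zero (suc j)))) (O-const (- A zero (suc j))))
        (det-O λ r c → charMatrix-O A (suc r) (punchIn (suc j) c)))))))
  where
  D rest : ℤ → ℤ
  D t = det (charMatrix (λ r c → A (suc r) (suc c)) t)
  rest t = sumFin (λ j → - sign (toℕ j) * ((t * + 0 - A zero (suc j)) * det (minor (charMatrix A t) (suc j))))
  expand : ∀ t a d x r → + 1 * ((t * + 1 - a) * d) + r - t * x ≡ (t * + 1 - a) * (d - x) + (- a * x + r)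
  expand = solve-∀
  zero-coefficient : ∀ t a → t * + 0 - a ≡ - a
  zero-coefficient = solve-∀

charMatrix-multiple : ∀ {m} (A : Matrix m) c → Below m (λ t → c * det (charMatrix A t)) → c ≡ + 0
charMatrix-multiple {m} A c b = Below-power c
  (Below-cong (λ t → cancel c (det (charMatrix A t)) (t ℤ.^ m))
    (Below-- b (Below-*ˡ (O-const c) (charMatrix-monic A))))
  where
  cancel : ∀ c p x → c * p - c * (p - x) ≡ c * x
  cancel = solve-∀

-- For m < k the common polynomial would grow too slowly to have leading coefficient 1 in degree k.
charMatrix-degree-≮ : ∀ {m k} (A : Matrix m) (A′ : Matrix k) →
  (∀ t → det (charMatrix A t) ≡ det (charMatrix A′ t)) → ¬ m ℕ.< k
charMatrix-degree-≮ A A′ eq m<k = contradiction (charMatrix-multiple A′ (+ 1) (below (O-mono m<k scaled))) (λ ())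
  where
  open Below (Below-cong (λ t → trans (eq t) (sym (ℤ.*-identityˡ (det (charMatrix A′ t)))))
    (O⇒Below (det-O (charMatrix-O A))))

charMatrix-degree : ∀ {m k} (A : Matrix m) (A′ : Matrix k) →
  (∀ t → det (charMatrix A t) ≡ det (charMatrix A′ t)) → m ≡ k
charMatrix-degree A A′ eq =
  ℕ.≤-antisym (ℕ.≮⇒≥ (charMatrix-degree-≮ A′ A (sym ∘ eq))) (ℕ.≮⇒≥ (charMatrix-degree-≮ A A′ eq))

act : ∀ {m} → Matrix m → Vector m → Vector m
act A x u = sumFin (λ v → A u v * x v)

iter : ∀ {m} → Matrix m → ℕ → Vector m → Vector m
iter A zero    x = x
iter A (suc k) x = act A (iter A k x)

trace : ∀ {m} → Matrix m → ℕ → ℤ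
trace A k = sumFin (λ i → iter A k (identity i) i)

-- For symmetric A this is the trace of Aᵏ adj (tI − A).
adjugateTrace : ∀ {m} → Matrix m → ℕ → ℤ → ℤ
adjugateTrace A k t = sumFin (λ i → det (setRow (charMatrix A t) i (iter A k (identity i))))

det-setRow-row : ∀ {m} (M : Matrix m) i w → det (setRow M i (M w)) ≡ identity i w * det M
det-setRow-row M i w with i Finₚ.≟ w
... | yes refl rewrite identity-diag i = trans (det-setRow-id M i (λ c → refl)) (sym (ℤ.*-identityˡ (det M)))
... | no i≢w rewrite identity-off i≢w = det-equal-rows (setRow M i (M w)) i w i≢w λ c →
  trans (cong-app (updateAt-updates i M) c) (sym (cong-app (updateAt-minimal w i M (i≢w ∘ sym)) c))

-- Cramer's rule: for symmetric A the row (tI - A) x is the combination of the rows of tI - A with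
-- coefficients x, and putting row w in place of row i gives the determinant if w = i and 0
-- otherwise.
adjugateTrace-step : ∀ {m} (A : Matrix m) → (∀ u v → A u v ≡ A v u) →
  ∀ k t → t * adjugateTrace A k t - adjugateTrace A (suc k) t ≡ trace A k * det (charMatrix A t)
adjugateTrace-step {m} A A-sym k t = begin
  t * adjugateTrace A k t - adjugateTrace A (suc k) t
    ≡⟨ cong₂ (λ x y → x - y) (sym (sumFin-*ˡ t (λ i → det (setRow N i (R i))))) refl ⟩
  sumFin (λ i → t * det (setRow N i (R i))) - adjugateTrace A (suc k) t
    ≡⟨ sym (sumFin-- (λ i → t * det (setRow N i (R i))) (λ i → det (setRow N i (act A (R i))))) ⟩
  sumFin (λ i → t * det (setRow N i (R i)) - det (setRow N i (act A (R i))))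
    ≡⟨ sumFin-cong diagonal ⟩
  sumFin (λ i → R i i * det N)
    ≡⟨ sumFin-*ʳ (λ i → R i i) (det N) ⟩
  trace A k * det N ∎
  where
  N : Matrix m
  N = charMatrix A t
  R : Fin m → Vector m
  R i = iter A k (identity i)
  expand : ∀ t e a x → x * (t * e - a) ≡ t * (e * x) + ℤ.-1ℤ * (a * x)
  expand = solve-∀
  reorder : ∀ x e d → x * (e * d) ≡ e * (x * d)
  reorder = solve-∀
  combination : ∀ x c → t * x c + ℤ.-1ℤ * act A x c ≡ sumFin (λ w → x w * N w c)
  combination x c = begin
    t * x c + ℤ.-1ℤ * act A x c
      ≡⟨ cong₂ (λ y z → t * y + ℤ.-1ℤ * z) (sym (sumFin-identity c x)) refl ⟩
    t * sumFin (λ w → identity c w * x w) + ℤ.-1ℤ * act A x c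
      ≡⟨ sym (cong₂ _+_ (sumFin-*ˡ t (λ w → identity c w * x w)) (sumFin-*ˡ ℤ.-1ℤ (λ w → A c w * x w))) ⟩
    sumFin (λ w → t * (identity c w * x w)) + sumFin (λ w → ℤ.-1ℤ * (A c w * x w))
      ≡⟨ sym (sumFin-+ (λ w → t * (identity c w * x w)) (λ w → ℤ.-1ℤ * (A c w * x w))) ⟩
    sumFin (λ w → t * (identity c w * x w) + ℤ.-1ℤ * (A c w * x w))
      ≡⟨ sumFin-cong (λ w → trans (cong₂ (λ e a → t * (e * x w) + ℤ.-1ℤ * (a * x w)) (identity-sym c w) (A-sym c w))
           (sym (expand t (identity w c) (A w c) (x w)))) ⟩
    sumFin (λ w → x w * N w c) ∎
  diagonal : ∀ i → t * det (setRow N i (R i)) - det (setRow N i (act A (R i))) ≡ R i i * det N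
  diagonal i = begin
    t * det (setRow N i (R i)) - det (setRow N i (act A (R i)))
      ≡⟨ cong (_+_ (t * det (setRow N i (R i)))) (sym (ℤ.-1*i≡-i (det (setRow N i (act A (R i)))))) ⟩
    t * det (setRow N i (R i)) + ℤ.-1ℤ * det (setRow N i (act A (R i)))
      ≡⟨ sym (det-setRow-combine N i t ℤ.-1ℤ (R i) (act A (R i))) ⟩
    det (setRow N i (λ c → t * R i c + ℤ.-1ℤ * act A (R i) c))
      ≡⟨ det-setRow-cong N i (combination (R i)) ⟩
    det (setRow N i (λ c → sumFin (λ w → R i w * N w c)))
      ≡⟨ det-setRow-linear N i (R i) N ⟩
    sumFin (λ w → R i w * det (setRow N i (N w)))
      ≡⟨ sumFin-cong (λ w → trans (cong (R i w *_) (det-setRow-row N i w)) (reorder (R i w) (identity i w) (det N))) ⟩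
    sumFin (λ w → identity i w * (R i w * det N))
      ≡⟨ sumFin-identity i (λ w → R i w * det N) ⟩
    R i i * det N ∎

adjugateTrace-Below : ∀ {m} (A : Matrix m) k → Below m (adjugateTrace A k)
adjugateTrace-Below A k = Below-sumFin λ i → det-setRow-Below (charMatrix-O A) i (iter A k (identity i))

charMatrix-derivative : ∀ {m} (A : Matrix m) → HasDerivative (λ t → det (charMatrix A t)) (adjugateTrace A 0)
charMatrix-derivative A = derivative-det {M = charMatrix A} {λ _ → identity} λ i j → derivative λ t h →
  + 0 , affine t h (identity i j) (A i j)
  where
  affine : ∀ t h e a → (t + h) * e - a ≡ t * e - a + h * e + h * h * + 0
  affine = solve-∀

module _ {m} {A A′ : Matrix m} (A-sym : ∀ u v → A u v ≡ A v u) (A′-sym : ∀ u v → A′ u v ≡ A′ v u)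
  (eq : ∀ t → det (charMatrix A t) ≡ det (charMatrix A′ t)) where

  private
    isolate : ∀ x y → y ≡ x - (x - y)
    isolate = solve-∀

    same-trace : ∀ k → (∀ t → adjugateTrace A k t ≡ adjugateTrace A′ k t) → trace A k ≡ trace A′ k
    same-trace k same = ℤ.i-j≡0⇒i≡j (trace A k) (trace A′ k) (charMatrix-multiple A (trace A k - trace A′ k)
      (Below-cong difference (Below-- (adjugateTrace-Below A′ (suc k)) (adjugateTrace-Below A (suc k)))))
      where
      regroup : ∀ x a a′ → a′ - a ≡ (x - a) - (x - a′)
      regroup = solve-∀
      factor : ∀ d a b → a * d - b * d ≡ (a - b) * d
      factor = solve-∀
      difference : ∀ t → adjugateTrace A′ (suc k) t - adjugateTrace A (suc k) t ≡ (trace A k - trace A′ k) * det (charMatrix A t)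
      difference t = begin
        adjugateTrace A′ (suc k) t - adjugateTrace A (suc k) t
          ≡⟨ regroup (t * adjugateTrace A k t) (adjugateTrace A (suc k) t) (adjugateTrace A′ (suc k) t) ⟩
        (t * adjugateTrace A k t - adjugateTrace A (suc k) t) - (t * adjugateTrace A k t - adjugateTrace A′ (suc k) t)
          ≡⟨ cong₂ (λ x y → x - y) (adjugateTrace-step A A-sym k t)
               (trans (cong (λ x → t * x - adjugateTrace A′ (suc k) t) (same t))
                 (trans (adjugateTrace-step A′ A′-sym k t) (cong (trace A′ k *_) (sym (eq t))))) ⟩
        trace A k * det (charMatrix A t) - trace A′ k * det (charMatrix A t)
          ≡⟨ factor (det (charMatrix A t)) (trace A k) (trace A′ k) ⟩
        (trace A k - trace A′ k) * det (charMatrix A t) ∎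

    same-adjugateTrace : ∀ k t → adjugateTrace A k t ≡ adjugateTrace A′ k t
    same-adjugateTrace zero    = derivative-unique eq (charMatrix-derivative A) (charMatrix-derivative A′)
    same-adjugateTrace (suc k) t = begin
      adjugateTrace A (suc k) t
        ≡⟨ isolate (t * adjugateTrace A k t) (adjugateTrace A (suc k) t) ⟩
      t * adjugateTrace A k t - (t * adjugateTrace A k t - adjugateTrace A (suc k) t)
        ≡⟨ cong₂ (λ x y → t * x - y) (same-adjugateTrace k t)
             (trans (adjugateTrace-step A A-sym k t) (trans (cong₂ _*_ (same-trace k (same-adjugateTrace k)) (eq t)) (sym (adjugateTrace-step A′ A′-sym k t)))) ⟩
      t * adjugateTrace A′ k t - (t * adjugateTrace A′ k t - adjugateTrace A′ (suc k) t)
        ≡⟨ sym (isolate (t * adjugateTrace A′ k t) (adjugateTrace A′ (suc k) t)) ⟩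
      adjugateTrace A′ (suc k) t ∎

  cospectral⇒trace : ∀ k → trace A k ≡ trace A′ k
  cospectral⇒trace k = same-trace k (same-adjugateTrace k)

-- The friendship graph

-- The leaves 2k and 2k + 1 share a triangle; `flip` exchanges them.
flip : ℕ → ℕ
flip zero          = 1
flip (suc zero)    = 0
flip (suc (suc i)) = suc (suc (flip i))

flip-involutive : ∀ i → flip (flip i) ≡ i
flip-involutive zero          = refl
flip-involutive (suc zero)    = refl
flip-involutive (suc (suc i)) = cong (λ j → suc (suc j)) (flip-involutive i)

flip-< : ∀ n {i} → i ℕ.< n ℕ.+ n → flip i ℕ.< n ℕ.+ n
flip-< (suc n) {i} i<n+n rewrite ℕ.+-suc n n = bound i i<n+n
  where
  bound : ∀ i → i ℕ.< suc (suc (n ℕ.+ n)) → flip i ℕ.< suc (suc (n ℕ.+ n))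
  bound zero          _ = ℕ.s≤s (ℕ.s≤s ℕ.z≤n)
  bound (suc zero)    _ = ℕ.s≤s ℕ.z≤n
  bound (suc (suc i)) (ℕ.s≤s (ℕ.s≤s h)) = ℕ.s≤s (ℕ.s≤s (flip-< n h))

same-half : ∀ i j → (not (i ≡ᵇ j) ∧ ((i / 2) ≡ᵇ (j / 2))) ≡ (flip i ≡ᵇ j)
same-half zero          zero          = refl
same-half zero          (suc zero)    = refl
same-half zero          (suc (suc j)) rewrite m/n≡1+[m∸n]/n {suc (suc j)} {2} (ℕ.s≤s (ℕ.s≤s ℕ.z≤n)) = refl
same-half (suc zero)    zero          = refl
same-half (suc zero)    (suc zero)    = refl
same-half (suc zero)    (suc (suc j)) rewrite m/n≡1+[m∸n]/n {suc (suc j)} {2} (ℕ.s≤s (ℕ.s≤s ℕ.z≤n)) = refl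
same-half (suc (suc i)) zero          rewrite m/n≡1+[m∸n]/n {suc (suc i)} {2} (ℕ.s≤s (ℕ.s≤s ℕ.z≤n)) = refl
same-half (suc (suc i)) (suc zero)    rewrite m/n≡1+[m∸n]/n {suc (suc i)} {2} (ℕ.s≤s (ℕ.s≤s ℕ.z≤n)) = refl
same-half (suc (suc i)) (suc (suc j))
  rewrite m/n≡1+[m∸n]/n {suc (suc i)} {2} (ℕ.s≤s (ℕ.s≤s ℕ.z≤n))
        | m/n≡1+[m∸n]/n {suc (suc j)} {2} (ℕ.s≤s (ℕ.s≤s ℕ.z≤n)) = same-half i j

partner : ∀ n → Fin (n ℕ.+ n) → Fin (n ℕ.+ n)
partner n i = Fin.fromℕ< (flip-< n (Finₚ.toℕ<n i))

toℕ-partner : ∀ n i → toℕ (partner n i) ≡ flip (toℕ i)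
toℕ-partner n i = Finₚ.toℕ-fromℕ< (flip-< n (Finₚ.toℕ<n i))

partner-involutive : ∀ n i → partner n (partner n i) ≡ i
partner-involutive n i = Finₚ.toℕ-injective (trans (toℕ-partner n (partner n i))
  (trans (cong flip (toℕ-partner n i)) (flip-involutive (toℕ i))))

friendship-leaves : ∀ n i j → adj (friendship n) (suc i) (suc j) ≡ (toℕ (partner n i) ≡ᵇ toℕ j)
friendship-leaves n i j = trans (same-half (toℕ i) (toℕ j)) (cong (_≡ᵇ toℕ j) (sym (toℕ-partner n i)))

sumFin-partner : ∀ n (f : Vector (n ℕ.+ n)) → sumFin (f ∘ partner n) ≡ sumFin f
sumFin-partner n f = trans (sumFin≡sum (f ∘ partner n)) (trans (sym (Σ.sum-permute f π)) (sym (sumFin≡sum f)))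
  where
  π : Permutation (n ℕ.+ n) (n ℕ.+ n)
  π = permutation (partner n) (partner n) (partner-involutive n) (partner-involutive n)

-- The coefficients of (t² − 1)(t² − t − N).
combination : ℤ → ℤ → ℤ → ℤ → ℤ → ℤ → ℤ
combination N a b c d e = a - b - (+ 1 + N) * c + d + N * e

quartic : ∀ {m} → Matrix m → ℤ → Vector m → Vector m
quartic A N x u = combination N (iter A 4 x u) (iter A 3 x u) (iter A 2 x u) (iter A 1 x u) (x u)

combination-cong : ∀ N {a b c d e a′ b′ c′ d′ e′} → a ≡ a′ → b ≡ b′ → c ≡ c′ → d ≡ d′ → e ≡ e′ →
  combination N a b c d e ≡ combination N a′ b′ c′ d′ e′
combination-cong N refl refl refl refl refl = refl

combination-*ˡ : ∀ N x a b c d e →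
  x * combination N a b c d e ≡ combination N (x * a) (x * b) (x * c) (x * d) (x * e)
combination-*ˡ = expand
  where
  expand : ∀ N x a b c d e → x * (a - b - (+ 1 + N) * c + d + N * e) ≡
    x * a - x * b - (+ 1 + N) * (x * c) + x * d + N * (x * e)
  expand = solve-∀

sumFin-combination : ∀ {m} N (a b c d e : Vector m) →
  sumFin (λ i → combination N (a i) (b i) (c i) (d i) (e i)) ≡
  combination N (sumFin a) (sumFin b) (sumFin c) (sumFin d) (sumFin e)
sumFin-combination N a b c d e = begin
  sumFin (λ i → a i - b i - (+ 1 + N) * c i + d i + N * e i)
    ≡⟨ sumFin-+ (λ i → a i - b i - (+ 1 + N) * c i + d i) (λ i → N * e i) ⟩
  sumFin (λ i → a i - b i - (+ 1 + N) * c i + d i) + sumFin (λ i → N * e i)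
    ≡⟨ cong₂ _+_ (sumFin-+ (λ i → a i - b i - (+ 1 + N) * c i) d) (sumFin-*ˡ N e) ⟩
  sumFin (λ i → a i - b i - (+ 1 + N) * c i) + sumFin d + N * sumFin e
    ≡⟨ cong (λ x → x + sumFin d + N * sumFin e) (trans
         (sumFin-- (λ i → a i - b i) (λ i → (+ 1 + N) * c i))
         (cong₂ (λ x y → x - y) (sumFin-- a b) (sumFin-*ˡ (+ 1 + N) c))) ⟩
  combination N (sumFin a) (sumFin b) (sumFin c) (sumFin d) (sumFin e) ∎

module Friendship (n : ℕ) where

  private
    F : Matrix (suc (n ℕ.+ n))
    F = adjMatrix (friendship n)
    N : ℤ
    N = + (n ℕ.+ n)
    leaves : Vector (suc (n ℕ.+ n)) → ℤ
    leaves x = sumFin (x ∘ suc)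

  act-hub : ∀ x → act F x zero ≡ leaves x
  act-hub x = trans (ℤ.+-identityˡ _) (sumFin-cong λ j → ℤ.*-identityˡ (x (suc j)))

  act-leaf : ∀ x i → act F x (suc i) ≡ x zero + x (suc (partner n i))
  act-leaf x i = cong₂ _+_ (ℤ.*-identityˡ (x zero)) (trans
    (sumFin-cong λ j → cong (λ a → (if a then + 1 else + 0) * x (suc j)) (friendship-leaves n i j))
    (sumFin-identity (partner n i) (x ∘ suc)))

  leaves-act : ∀ x → leaves (act F x) ≡ N * x zero + leaves x
  leaves-act x = trans (sumFin-cong (act-leaf x)) (trans
    (sumFin-+ (const (x zero)) (λ i → x (suc (partner n i))))
    (cong₂ _+_ (sumFin-const (n ℕ.+ n) (x zero)) (sumFin-partner n (x ∘ suc))))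

  act²-hub : ∀ x → iter F 2 x zero ≡ N * x zero + leaves x
  act²-hub x = trans (act-hub (act F x)) (leaves-act x)

  act²-leaf : ∀ x i → iter F 2 x (suc i) ≡ leaves x + (x zero + x (suc i))
  act²-leaf x i = trans (act-leaf (act F x) i) (cong₂ _+_ (act-hub x) (trans
    (act-leaf x (partner n i)) (cong (λ j → x zero + x (suc j)) (partner-involutive n i))))

  -- The hub value, the sum over the leaves and the values at a leaf and its partner are mapped to
  -- linear combinations of themselves, so each kind of vertex leaves one polynomial identity.
  quartic≡0 : ∀ x u → quartic F N x u ≡ + 0
  quartic≡0 x zero
    rewrite act²-hub (act F (act F x)) | act²-hub (act F x) | act²-hub x | leaves-act (act F x) | leaves-act x | act-hub x
    = identity₀ N (x zero) (leaves x)
    where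
    identity₀ : ∀ N h s → N * (N * h + s) + (N * s + (N * h + s)) - (N * s + (N * h + s))
      - (+ 1 + N) * (N * h + s) + s + N * h ≡ + 0
    identity₀ = solve-∀
  quartic≡0 x (suc i)
    rewrite act²-leaf (act F (act F x)) i | act²-leaf (act F x) i | act²-hub x | act²-leaf x i
          | leaves-act (act F x) | leaves-act x | act-hub x | act-leaf x i
    = identity₁ N (x zero) (leaves x) (x (suc i)) (x (suc (partner n i)))
    where
    identity₁ : ∀ N h s y z → N * s + (N * h + s) + (N * h + s + (s + (h + y))) - (N * h + s + (s + (h + z)))
      - (+ 1 + N) * (s + (h + y)) + (h + z) + N * y ≡ + 0
    identity₁ = solve-∀

  trace² : trace F 2 ≡ + 3 * N
  trace² = begin
    iter F 2 (identity zero) zero + sumFin (λ i → iter F 2 (identity (suc i)) (suc i))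
      ≡⟨ cong₂ _+_ (act²-hub (identity zero)) (sumFin-cong λ i → trans (act²-leaf (identity (suc i)) i)
           (cong₂ (λ a b → a + (+ 0 + b)) (one i) (identity-diag i))) ⟩
    N * + 1 + leaves (identity zero) + sumFin {n ℕ.+ n} (λ i → + 2)
      ≡⟨ cong₂ (λ a b → N * + 1 + a + b) (sumFin-zero {f = λ i → identity {suc (n ℕ.+ n)} zero (suc i)} λ i → refl) (sumFin-const (n ℕ.+ n) (+ 2)) ⟩
    N * + 1 + + 0 + N * + 2
      ≡⟨ total N ⟩
    + 3 * N ∎
    where
    one : ∀ {m} (i : Fin m) → sumFin (identity i) ≡ + 1
    one i = trans (sumFin-cong λ j → sym (ℤ.*-identityʳ (identity i j))) (sumFin-identity i (const (+ 1)))
    total : ∀ N → N * + 1 + + 0 + N * + 2 ≡ + 3 * N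
    total = solve-∀

-- Order on sums

square-nonneg : ∀ i → + 0 ℤ.≤ i * i
square-nonneg (+ n)    = subst (+ 0 ℤ.≤_) (ℤ.pos-* n n) (ℤ.+≤+ ℕ.z≤n)
square-nonneg -[1+ n ] = ℤ.+≤+ ℕ.z≤n

sumFin-nonneg : ∀ {m} {f : Vector m} → (∀ i → + 0 ℤ.≤ f i) → + 0 ℤ.≤ sumFin f
sumFin-nonneg {zero}  le = ℤ.≤-refl
sumFin-nonneg {suc m} le = ℤ.+-mono-≤ (le zero) (sumFin-nonneg (le ∘ suc))

term≤sumFin : ∀ {m} {f : Vector m} → (∀ i → + 0 ℤ.≤ f i) → ∀ i → f i ℤ.≤ sumFin f
term≤sumFin {f = f} le zero = subst (ℤ._≤ sumFin f) (ℤ.+-identityʳ (f zero))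
  (ℤ.+-monoʳ-≤ (f zero) (sumFin-nonneg (le ∘ suc)))
term≤sumFin {f = f} le (suc i) = subst (ℤ._≤ sumFin f) (ℤ.+-identityˡ (f (suc i)))
  (ℤ.+-mono-≤ (le zero) (term≤sumFin (le ∘ suc) i))

sumFin≡0⇒term≡0 : ∀ {m} {f : Vector m} → (∀ i → + 0 ℤ.≤ f i) → sumFin f ≡ + 0 → ∀ i → f i ≡ + 0
sumFin≡0⇒term≡0 {f = f} le eq i = ℤ.≤-antisym (subst (f i ℤ.≤_) eq (term≤sumFin le i)) (le i)

square≡0 : ∀ i → i * i ≡ + 0 → i ≡ + 0
square≡0 i eq with ℤ.i*j≡0⇒i≡0∨j≡0 i eq
... | inj₁ e = e
... | inj₂ e = e

-- Symmetric operators

dot : ∀ {m} → Vector m → Vector m → ℤ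
dot x y = sumFin (λ u → x u * y u)

dot-identity : ∀ {m} (i : Fin m) y → dot (identity i) y ≡ y i
dot-identity i y = sumFin-identity i y

dot-comm : ∀ {m} (x y : Vector m) → dot x y ≡ dot y x
dot-comm x y = sumFin-cong λ u → ℤ.*-comm (x u) (y u)

dot-combine : ∀ {m} a b (x y z : Vector m) → dot x (λ u → a * y u + b * z u) ≡ a * dot x y + b * dot x z
dot-combine a b x y z = begin
  sumFin (λ u → x u * (a * y u + b * z u))
    ≡⟨ sumFin-cong (λ u → expand a b (x u) (y u) (z u)) ⟩
  sumFin (λ u → a * (x u * y u) + b * (x u * z u))
    ≡⟨ sumFin-+ (λ u → a * (x u * y u)) (λ u → b * (x u * z u)) ⟩
  sumFin (λ u → a * (x u * y u)) + sumFin (λ u → b * (x u * z u))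
    ≡⟨ cong₂ _+_ (sumFin-*ˡ a (λ u → x u * y u)) (sumFin-*ˡ b (λ u → x u * z u)) ⟩
  a * dot x y + b * dot x z ∎
  where
  expand : ∀ a b x y z → x * (a * y + b * z) ≡ a * (x * y) + b * (x * z)
  expand = solve-∀

dot-- : ∀ {m} (x y z : Vector m) → dot x (λ u → y u - z u) ≡ dot x y - dot x z
dot-- x y z = trans (sumFin-cong λ u → distrib (x u) (y u) (z u))
  (sumFin-- (λ u → x u * y u) (λ u → x u * z u))
  where
  distrib : ∀ a x y → a * (x - y) ≡ a * x - a * y
  distrib = solve-∀

dot-nonneg : ∀ {m} (x : Vector m) → + 0 ℤ.≤ dot x x
dot-nonneg x = sumFin-nonneg λ u → square-nonneg (x u)

dot≡0 : ∀ {m} (x : Vector m) → dot x x ≡ + 0 → ∀ u → x u ≡ + 0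
dot≡0 x eq u = square≡0 (x u) (sumFin≡0⇒term≡0 (λ u → square-nonneg (x u)) eq u)

act-cong : ∀ {m} (A : Matrix m) {x y} → (∀ u → x u ≡ y u) → ∀ u → act A x u ≡ act A y u
act-cong A eq u = sumFin-cong λ v → cong (A u v *_) (eq v)

act-combine : ∀ {m} (A : Matrix m) a b x y u →
  act A (λ v → a * x v + b * y v) u ≡ a * act A x u + b * act A y u
act-combine A a b x y u = dot-combine a b (A u) x y

act-- : ∀ {m} (A : Matrix m) x y u → act A (λ v → x v - y v) u ≡ act A x u - act A y u
act-- A x y u = dot-- (A u) x y

iter-combine : ∀ {m} (A : Matrix m) k a b x y u →
  iter A k (λ v → a * x v + b * y v) u ≡ a * iter A k x u + b * iter A k y u
iter-combine A zero    a b x y u = refl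
iter-combine A (suc k) a b x y u = trans (act-cong A (iter-combine A k a b x y) u)
  (act-combine A a b (iter A k x) (iter A k y) u)

iter-expand : ∀ {m} (A : Matrix m) k x u → iter A k x u ≡ sumFin (λ v → x v * iter A k (identity v) u)
iter-expand A zero x u = sym (trans
  (sumFin-cong λ v → trans (cong (x v *_) (identity-sym v u)) (ℤ.*-comm (x v) (identity u v)))
  (sumFin-identity u x))
iter-expand A (suc k) x u = begin
  sumFin (λ w → A u w * iter A k x w)
    ≡⟨ sumFin-cong (λ w → trans (cong (A u w *_) (iter-expand A k x w))
         (sym (sumFin-*ˡ (A u w) (λ v → x v * R v w)))) ⟩
  sumFin (λ w → sumFin (λ v → A u w * (x v * R v w)))
    ≡⟨ sumFin-swap (λ w v → A u w * (x v * R v w)) ⟩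
  sumFin (λ v → sumFin (λ w → A u w * (x v * R v w)))
    ≡⟨ sumFin-cong (λ v → trans (sumFin-cong λ w → exchange (A u w) (x v) (R v w))
         (sumFin-*ˡ (x v) (λ w → A u w * R v w))) ⟩
  sumFin (λ v → x v * act A (R v) u) ∎
  where
  R : ∀ v → Vector _
  R v = iter A k (identity v)
  exchange : ∀ a x r → a * (x * r) ≡ x * (a * r)
  exchange = solve-∀

iter-+ : ∀ {m} (A : Matrix m) j k x → iter A j (iter A k x) ≡ iter A (j ℕ.+ k) x
iter-+ A zero    k x = refl
iter-+ A (suc j) k x = cong (act A) (iter-+ A j k x)

module Symmetric {m} (A : Matrix m) (A-sym : ∀ u v → A u v ≡ A v u) where

  dot-act : ∀ x y → dot x (act A y) ≡ dot (act A x) y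
  dot-act x y = begin
    sumFin (λ u → x u * sumFin (λ v → A u v * y v))
      ≡⟨ sumFin-cong (λ u → sym (sumFin-*ˡ (x u) (λ v → A u v * y v))) ⟩
    sumFin (λ u → sumFin (λ v → x u * (A u v * y v)))
      ≡⟨ sumFin-swap (λ u v → x u * (A u v * y v)) ⟩
    sumFin (λ v → sumFin (λ u → x u * (A u v * y v)))
      ≡⟨ sumFin-cong (λ v → trans
           (sumFin-cong λ u → trans (cong (λ a → x u * (a * y v)) (A-sym u v)) (reorder (x u) (A v u) (y v)))
           (sumFin-*ʳ (λ u → A v u * x u) (y v))) ⟩
    sumFin (λ v → act A x v * y v) ∎
    where
    reorder : ∀ x a y → x * (a * y) ≡ a * x * y
    reorder = solve-∀

  dot-iter : ∀ j k x → dot (iter A j x) (iter A k x) ≡ dot x (iter A (j ℕ.+ k) x)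
  dot-iter zero    k x = refl
  dot-iter (suc j) k x = trans (sym (dot-act (iter A j x) (iter A k x)))
    (trans (dot-iter j (suc k) x) (cong (λ e → dot x (iter A e x)) (ℕ.+-suc j k)))

-- Transfer of the annihilating polynomial

dot-quartic : ∀ {m} (A : Matrix m) N (x y : Vector m) → dot y (quartic A N x) ≡
  combination N (dot y (iter A 4 x)) (dot y (iter A 3 x)) (dot y (iter A 2 x)) (dot y (iter A 1 x)) (dot y x)
dot-quartic A N x y = trans
  (sumFin-cong λ u → combination-*ˡ N (y u) (iter A 4 x u) (iter A 3 x u) (iter A 2 x u) (iter A 1 x u) (x u))
  (sumFin-combination N (λ u → y u * iter A 4 x u) (λ u → y u * iter A 3 x u) (λ u → y u * iter A 2 x u)
    (λ u → y u * iter A 1 x u) (λ u → y u * x u))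

-- With f(A) = (A² − I)(A² − A − N I), the traces of the powers of A determine Σ_i |f(A) e_i|².
quartic-trace : ∀ {m k} (A : Matrix m) (A′ : Matrix k) N →
  (∀ u v → A u v ≡ A v u) → (∀ e → trace A e ≡ trace A′ e) →
  (∀ x u → quartic A′ N x u ≡ + 0) → ∀ x u → quartic A N x u ≡ + 0
quartic-trace {m} {k} A A′ N A-sym same-trace vanishes x u = begin
  quartic A N x u
    ≡⟨ combination-cong N (iter-expand A 4 x u) (iter-expand A 3 x u) (iter-expand A 2 x u)
         (iter-expand A 1 x u) (iter-expand A 0 x u) ⟩
  combination N (dot x (R 4)) (dot x (R 3)) (dot x (R 2)) (dot x (R 1)) (dot x (R 0))
    ≡⟨ sym (sumFin-combination N (λ v → x v * R 4 v) (λ v → x v * R 3 v) (λ v → x v * R 2 v)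
         (λ v → x v * R 1 v) (λ v → x v * R 0 v)) ⟩
  sumFin (λ v → combination N (x v * R 4 v) (x v * R 3 v) (x v * R 2 v) (x v * R 1 v) (x v * R 0 v))
    ≡⟨ sumFin-zero (λ v → trans (sym (combination-*ˡ N (x v) (R 4 v) (R 3 v) (R 2 v) (R 1 v) (R 0 v)))
         (trans (cong (x v *_) (basis v u)) (ℤ.*-zeroʳ (x v)))) ⟩
  + 0 ∎
  where
  open Symmetric A A-sym
  R : ℕ → Vector m
  R e v = iter A e (identity v) u
  shifted-trace : ∀ {m} (A : Matrix m) e → sumFin (λ i → quartic A N (iter A e (identity i)) i) ≡
    combination N (trace A (4 ℕ.+ e)) (trace A (3 ℕ.+ e)) (trace A (2 ℕ.+ e)) (trace A (1 ℕ.+ e)) (trace A e)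
  shifted-trace A e = sumFin-combination N (t 4) (t 3) (t 2) (t 1) (t 0)
    where
    t : ℕ → Vector _
    t j i = iter A j (iter A e (identity i)) i
  -- `L e i` is the diagonal entry of f(A) Aᵉ at i. Expanding one factor of ∣f(A) eᵢ∣² gives a
  -- combination of `L 4 i`, ..., `L 0 i`, each of which sums to zero over i.
  L : ℕ → Vector m
  L e i = quartic A N (iter A e (identity i)) i
  ΣL≡0 : ∀ e → sumFin (L e) ≡ + 0
  ΣL≡0 e = begin
    sumFin (L e)
      ≡⟨ shifted-trace A e ⟩
    combination N (trace A (4 ℕ.+ e)) (trace A (3 ℕ.+ e)) (trace A (2 ℕ.+ e)) (trace A (1 ℕ.+ e)) (trace A e)
      ≡⟨ combination-cong N (same-trace (4 ℕ.+ e)) (same-trace (3 ℕ.+ e)) (same-trace (2 ℕ.+ e))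
           (same-trace (1 ℕ.+ e)) (same-trace e) ⟩
    combination N (trace A′ (4 ℕ.+ e)) (trace A′ (3 ℕ.+ e)) (trace A′ (2 ℕ.+ e)) (trace A′ (1 ℕ.+ e)) (trace A′ e)
      ≡⟨ sym (shifted-trace A′ e) ⟩
    sumFin (λ i → quartic A′ N (iter A′ e (identity i)) i)
      ≡⟨ sumFin-zero (λ i → vanishes (iter A′ e (identity i)) i) ⟩
    + 0 ∎
  Q : Fin m → Vector m
  Q i = quartic A N (identity i)
  dot-Q : ∀ i e → dot (Q i) (iter A e (identity i)) ≡ L e i
  dot-Q i e = begin
    dot (Q i) y
      ≡⟨ dot-comm (Q i) y ⟩
    dot y (Q i)
      ≡⟨ dot-quartic A N (identity i) y ⟩
    combination N (dot y (iter A 4 (identity i))) (dot y (iter A 3 (identity i))) (dot y (iter A 2 (identity i)))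
      (dot y (iter A 1 (identity i))) (dot y (identity i))
      ≡⟨ combination-cong N (move 4) (move 3) (move 2) (move 1) (move 0) ⟩
    L e i ∎
    where
    y : Vector m
    y = iter A e (identity i)
    move : ∀ j → dot y (iter A j (identity i)) ≡ iter A j y i
    move j = begin
      dot y (iter A j (identity i))                     ≡⟨ dot-comm y (iter A j (identity i)) ⟩
      dot (iter A j (identity i)) y                     ≡⟨ dot-iter j e (identity i) ⟩
      dot (identity i) (iter A (j ℕ.+ e) (identity i))  ≡⟨ dot-identity i (iter A (j ℕ.+ e) (identity i)) ⟩
      iter A (j ℕ.+ e) (identity i) i                   ≡⟨ cong-app (sym (iter-+ A j e (identity i))) i ⟩
      iter A j y i                                      ∎
  total : sumFin (λ i → dot (Q i) (Q i)) ≡ + 0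
  total = begin
    sumFin (λ i → dot (Q i) (Q i))
      ≡⟨ sumFin-cong (λ i → trans (dot-quartic A N (identity i) (Q i))
           (combination-cong N (dot-Q i 4) (dot-Q i 3) (dot-Q i 2) (dot-Q i 1) (dot-Q i 0))) ⟩
    sumFin (λ i → combination N (L 4 i) (L 3 i) (L 2 i) (L 1 i) (L 0 i))
      ≡⟨ sumFin-combination N (L 4) (L 3) (L 2) (L 1) (L 0) ⟩
    combination N (sumFin (L 4)) (sumFin (L 3)) (sumFin (L 2)) (sumFin (L 1)) (sumFin (L 0))
      ≡⟨ combination-cong N (ΣL≡0 4) (ΣL≡0 3) (ΣL≡0 2) (ΣL≡0 1) (ΣL≡0 0) ⟩
    combination N (+ 0) (+ 0) (+ 0) (+ 0) (+ 0)
      ≡⟨ zeros N ⟩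
    + 0 ∎
    where
    zeros : ∀ N → + 0 - + 0 - (+ 1 + N) * + 0 + + 0 + N * + 0 ≡ + 0
    zeros = solve-∀
  basis : ∀ v u → Q v u ≡ + 0
  basis v = dot≡0 (Q v) (sumFin≡0⇒term≡0 (λ i → dot-nonneg (Q i)) total v)

-- The operator B = A² - I and its positivity

module QuarticOperator {m} (A : Matrix m) (A-sym : ∀ u v → A u v ≡ A v u)
  (N : ℤ) (annihilates : ∀ x u → quartic A N x u ≡ + 0) where

  open Symmetric A A-sym

  abstract
    B : Vector m → Vector m
    B x u = iter A 2 x u - x u

    B-def : ∀ x u → B x u ≡ iter A 2 x u - x u
    B-def x u = refl

    B-combine : ∀ a b x y u → B (λ v → a * x v + b * y v) u ≡ a * B x u + b * B y u
    B-combine a b x y u = trans (cong (_- (a * x u + b * y u)) (iter-combine A 2 a b x y u))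
      (regroup a b (iter A 2 x u) (iter A 2 y u) (x u) (y u))
      where
      regroup : ∀ a b p q x y → a * p + b * q - (a * x + b * y) ≡ a * (p - x) + b * (q - y)
      regroup = solve-∀

    B-cong : ∀ {x y} → (∀ u → x u ≡ y u) → ∀ u → B x u ≡ B y u
    B-cong eq u = cong₂ _-_ (act-cong A (act-cong A eq) u) (eq u)

    B-symmetric : ∀ x y → dot x (B y) ≡ dot (B x) y
    B-symmetric x y = begin
      dot x (B y)
        ≡⟨ dot-- x (iter A 2 y) y ⟩
      dot x (iter A 2 y) - dot x y
        ≡⟨ cong (_- dot x y) (trans (dot-act x (act A y)) (dot-act (act A x) y)) ⟩
      dot (iter A 2 x) y - dot x y
        ≡⟨ cong₂ (λ a b → a - b) (dot-comm (iter A 2 x) y) (dot-comm x y) ⟩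
      dot y (iter A 2 x) - dot y x
        ≡⟨ sym (dot-- y (iter A 2 x) x) ⟩
      dot y (B x)
        ≡⟨ dot-comm y (B x) ⟩
      dot (B x) y ∎

    B-act : ∀ x u → B (act A x) u ≡ act A (B x) u
    B-act x u = sym (act-- A (iter A 2 x) x u)

    -- The quartic factors as (A² - A - N)(A² - I), so its vanishing says that A² = A + N on the
    -- image of B.
    B-eigen : ∀ x u → iter A 2 (B x) u ≡ act A (B x) u + N * B x u
    B-eigen x u = begin
      iter A 2 (B x) u
        ≡⟨ trans (act-cong A (act-- A (iter A 2 x) x) u) (act-- A (iter A 3 x) (iter A 1 x) u) ⟩
      iter A 4 x u - iter A 2 x u
        ≡⟨ isolate N (iter A 4 x u) (iter A 3 x u) (iter A 2 x u) (iter A 1 x u) (x u) ⟩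
      quartic A N x u + (iter A 3 x u - iter A 1 x u + N * (iter A 2 x u - x u))
        ≡⟨ cong₂ _+_ (annihilates x u) (cong (_+ N * B x u) (sym (act-- A (iter A 2 x) x u))) ⟩
      + 0 + (act A (B x) u + N * B x u)
        ≡⟨ ℤ.+-identityˡ _ ⟩
      act A (B x) u + N * B x u ∎
      where
      isolate : ∀ N a b c d e → a - c ≡ a - b - (+ 1 + N) * c + d + N * e + (b - d + N * (c - e))
      isolate = solve-∀

  private
    dot-B : ∀ y x → dot y (B x) ≡ dot y (iter A 2 x) - dot y x
    dot-B y x = trans (sumFin-cong λ u → cong (y u *_) (B-def x u)) (dot-- y (iter A 2 x) x)

    dot-eigen : ∀ y x → dot y (iter A 2 (B x)) ≡ dot y (act A (B x)) + N * dot y (B x)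
    dot-eigen y x = begin
      dot y (iter A 2 (B x))
        ≡⟨ sumFin-cong (λ u → cong (y u *_) (trans (B-eigen x u) (cong (_+ N * B x u) (sym (ℤ.*-identityˡ (act A (B x) u)))))) ⟩
      dot y (λ u → + 1 * act A (B x) u + N * B x u)
        ≡⟨ dot-combine (+ 1) N y (act A (B x)) (B x) ⟩
      + 1 * dot y (act A (B x)) + N * dot y (B x)
        ≡⟨ cong (_+ N * dot y (B x)) (ℤ.*-identityˡ (dot y (act A (B x)))) ⟩
      dot y (act A (B x)) + N * dot y (B x) ∎

  B-square : ∀ x → dot (B x) (B x) ≡ dot x (act A (B x)) + (N - + 1) * dot x (B x)
  B-square x = begin
    dot (B x) (B x)
      ≡⟨ sym (B-symmetric x (B x)) ⟩
    dot x (B (B x))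
      ≡⟨ dot-B x (B x) ⟩
    dot x (iter A 2 (B x)) - dot x (B x)
      ≡⟨ cong (_- dot x (B x)) (dot-eigen x x) ⟩
    dot x (act A (B x)) + N * dot x (B x) - dot x (B x)
      ≡⟨ regroup N (dot x (act A (B x))) (dot x (B x)) ⟩
    dot x (act A (B x)) + (N - + 1) * dot x (B x) ∎
    where
    regroup : ∀ N p q → p + N * q - q ≡ p + (N - + 1) * q
    regroup = solve-∀

  -- On the image of B the eigenvalues of A are θ and 1 − θ with θ (1 − θ) = − N; for N > 2 this exhibits
  -- ⟨x , B x⟩ as a positive combination of squares.
  sum-of-squares : ∀ x → N * (N - + 2) * dot (B x) (B x) +
      dot (λ u → N * B x u + ℤ.-1ℤ * act A (B x) u) (λ u → N * B x u + ℤ.-1ℤ * act A (B x) u) ≡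
    N * (N - + 2) * (N + N - + 1) * dot x (B x)
  sum-of-squares x = begin
    N * (N - + 2) * dot b b + dot c c
      ≡⟨ cong (_+_ (N * (N - + 2) * dot b b)) (trans (dot-combine N ℤ.-1ℤ c b Ab) (cong₂ (λ p q → N * p + ℤ.-1ℤ * q)
           (trans (dot-comm c b) (dot-combine N ℤ.-1ℤ b b Ab)) (trans (dot-comm c Ab) (dot-combine N ℤ.-1ℤ Ab b Ab)))) ⟩
    N * (N - + 2) * dot b b + (N * (N * dot b b + ℤ.-1ℤ * dot b Ab) + ℤ.-1ℤ * (N * dot Ab b + ℤ.-1ℤ * dot Ab Ab))
      ≡⟨ cong₂ (λ p q → N * (N - + 2) * p + q) b·b (cong₂ (λ p q → N * p + ℤ.-1ℤ * q)
           (cong₂ (λ p q → N * p + ℤ.-1ℤ * q) b·b b·Ab) (cong₂ (λ p q → N * p + ℤ.-1ℤ * q) (trans (dot-comm Ab b) b·Ab) Ab·Ab)) ⟩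
    N * (N - + 2) * sq + (N * (N * sq + ℤ.-1ℤ * mixed) + ℤ.-1ℤ * (N * mixed + ℤ.-1ℤ * (mixed + N * sq)))
      ≡⟨ finish N α β ⟩
    N * (N - + 2) * (N + N - + 1) * α ∎
    where
    b Ab c : Vector m
    b = B x
    Ab = act A b
    -- On the image of B, A² = A + N gives (N - A)² + N (N - 2) = (2N - 1)(N - A). Moreover ⟨b , (N
    -- - A) b⟩ = N (N - 2) ⟨x , B x⟩, because β cancels.
    c u = N * b u + ℤ.-1ℤ * Ab u
    α β sq mixed : ℤ
    α = dot x b
    β = dot x Ab
    sq = β + (N - + 1) * α
    mixed = N * β + N * α
    b·b : dot b b ≡ sq
    b·b = B-square x
    b·Ab : dot b Ab ≡ mixed
    b·Ab = begin
      dot b Ab                               ≡⟨ sym (B-symmetric x Ab) ⟩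
      dot x (B Ab)                           ≡⟨ dot-B x Ab ⟩
      dot x (iter A 3 b) - β                 ≡⟨ cong (_- β) (trans (dot-act x (iter A 2 b)) (dot-eigen (act A x) x)) ⟩
      dot (act A x) Ab + N * dot (act A x) b - β
        ≡⟨ cong₂ (λ p q → p + N * q - β) (trans (sym (dot-act x Ab)) (dot-eigen x x)) (sym (dot-act x b)) ⟩
      β + N * α + N * β - β                  ≡⟨ regroup N α β ⟩
      mixed                                  ∎
      where
      regroup : ∀ N α β → β + N * α + N * β - β ≡ N * β + N * α
      regroup = solve-∀
    Ab·Ab : dot Ab Ab ≡ mixed + N * sq
    Ab·Ab = trans (sym (dot-act b Ab)) (trans (dot-eigen b x) (cong₂ (λ p q → p + N * q) b·Ab b·b))
    finish : ∀ N α β → N * (N - + 2) * (β + (N - + 1) * α) +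
        (N * (N * (β + (N - + 1) * α) + ℤ.-1ℤ * (N * β + N * α)) +
         ℤ.-1ℤ * (N * (N * β + N * α) + ℤ.-1ℤ * (N * β + N * α + N * (β + (N - + 1) * α)))) ≡
      N * (N - + 2) * (N + N - + 1) * α
    finish = solve-∀

module Semidefinite {m} (A : Matrix m) (A-sym : ∀ u v → A u v ≡ A v u)
  (k : ℕ) (annihilates : ∀ x u → quartic A (+ (3 ℕ.+ k)) x u ≡ + 0) where

  open QuarticOperator A A-sym (+ (3 ℕ.+ k)) annihilates public

  private
    N K L : ℤ
    N = + (3 ℕ.+ k)
    -- For N = 3 + k this and 2N - 1 are visibly positive; at N = 2 it would be zero.
    K = N * (N - + 2)
    L = N + N - + 1

    squares : Vector m → ℤ
    squares x = K * dot (B x) (B x) + dot (λ u → N * B x u + ℤ.-1ℤ * act A (B x) u) (λ u → N * B x u + ℤ.-1ℤ * act A (B x) u)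

    first-nonneg : ∀ x → + 0 ℤ.≤ K * dot (B x) (B x)
    first-nonneg x = subst (ℤ._≤ K * dot (B x) (B x)) (ℤ.*-zeroʳ K) (ℤ.*-monoˡ-≤-nonNeg K (dot-nonneg (B x)))

    second-nonneg : ∀ x → + 0 ℤ.≤ dot (λ u → N * B x u + ℤ.-1ℤ * act A (B x) u) (λ u → N * B x u + ℤ.-1ℤ * act A (B x) u)
    second-nonneg x = dot-nonneg (λ u → N * B x u + ℤ.-1ℤ * act A (B x) u)

  B-nonneg : ∀ x → + 0 ℤ.≤ dot x (B x)
  B-nonneg x = ℤ.*-cancelˡ-≤-pos (+ 0) (dot x (B x)) (K * L)
    (subst₂ ℤ._≤_ (sym (ℤ.*-zeroʳ (K * L))) (sum-of-squares x) (ℤ.+-mono-≤ (first-nonneg x) (second-nonneg x)))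

  -- When the form vanishes, so do both squares in `sum-of-squares`, and the first is a positive
  -- multiple of ∣B x∣².
  B-definite : ∀ x → dot x (B x) ≡ + 0 → ∀ u → B x u ≡ + 0
  B-definite x eq = dot≡0 (B x) (ℤ.*-cancelˡ-≡ K (dot (B x) (B x)) (+ 0) (trans
    (ℤ.≤-antisym (ℤ.≤-trans
        (subst (ℤ._≤ squares x) (ℤ.+-identityʳ _) (ℤ.+-monoʳ-≤ (K * dot (B x) (B x)) (second-nonneg x)))
        (ℤ.≤-reflexive (trans (sum-of-squares x) (trans (cong (K * L *_) eq) (ℤ.*-zeroʳ (K * L))))))
      (first-nonneg x))
    (sym (ℤ.*-zeroʳ K))))

-- Counting with weights

0≤+ : ∀ {x y} → + 0 ℤ.≤ x → + 0 ℤ.≤ y → + 0 ℤ.≤ x + y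
0≤+ = ℤ.+-mono-≤

≢0⇒0≤-1 : ∀ {x} → + 0 ℤ.≤ x → x ≢ + 0 → + 0 ℤ.≤ x - + 1
≢0⇒0≤-1 0≤x x≢0 = ℤ.i≤j⇒0≤j-i (ℤ.i<j⇒suc[i]≤j (ℤ.≤∧≢⇒< 0≤x (x≢0 ∘ sym)))

0≰negative : ∀ {x k} → + 0 ℤ.≤ x → x ≢ -[1+ k ]
0≰negative 0≤x refl = contradiction 0≤x (λ ())

identity-nonneg : ∀ {m} (i j : Fin m) → + 0 ℤ.≤ identity i j
identity-nonneg i j with i Finₚ.≟ j
... | yes refl = subst (+ 0 ℤ.≤_) (sym (identity-diag i)) (ℤ.+≤+ ℕ.z≤n)
... | no i≢j   = ℤ.≤-reflexive (sym (identity-off i≢j))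

sum-identity : ∀ {m} (i : Fin m) → sumFin (identity i) ≡ + 1
sum-identity i = trans (sumFin-cong λ j → sym (ℤ.*-identityʳ (identity i j))) (sumFin-identity i (const (+ 1)))

nonneg-off : ∀ {m} {W : Vector m} {v} → (∀ u → + 0 ℤ.≤ W u) → + 0 ℤ.≤ W v - + 1 → ∀ u → + 0 ℤ.≤ W u - identity v u
nonneg-off {W = W} {v} W≥0 Wv≥1 u with v Finₚ.≟ u
... | yes refl = subst (λ x → + 0 ℤ.≤ W u - x) (sym (identity-diag u)) Wv≥1
... | no v≢u   = subst (λ x → + 0 ℤ.≤ W u - x) (sym (identity-off v≢u))
  (subst (+ 0 ℤ.≤_) (sym (ℤ.+-identityʳ (W u))) (W≥0 u))

-- Every element of the list removes one unit at its own place; by uniqueness the later ones keep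
-- theirs.
length≤weight : ∀ {m} (W : Vector m) → (∀ u → + 0 ℤ.≤ W u) →
  ∀ {L} → Unique L → All (λ u → + 0 ℤ.≤ W u - + 1) L → + 0 ℤ.≤ sumFin W - + length L
length≤weight W W≥0 [] [] = subst (+ 0 ℤ.≤_) (sym (ℤ.+-identityʳ (sumFin W))) (sumFin-nonneg W≥0)
length≤weight {m} W W≥0 {v ∷ L} (v∉L ∷ unique) (Wv≥1 ∷ WL≥1) =
  subst (+ 0 ℤ.≤_) (trans (cong (_- + length L) (trans (sumFin-- W (identity v)) (cong (_-_ (sumFin W)) (sum-identity v))))
    (regroup (sumFin W) (+ length L)))
    (length≤weight (λ u → W u - identity v u) (nonneg-off W≥0 Wv≥1) unique (All.zipWith off (v∉L , WL≥1)))
  where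
  regroup : ∀ s l → s - + 1 - l ≡ s - (+ 1 + l)
  regroup = solve-∀
  off : ∀ {u} → (v ≢ u) × (+ 0 ℤ.≤ W u - + 1) → + 0 ℤ.≤ W u - identity v u - + 1
  off {u} (v≢u , le) = subst (λ x → + 0 ℤ.≤ W u - x - + 1) (sym (identity-off v≢u))
    (subst (λ x → + 0 ℤ.≤ x - + 1) (sym (ℤ.+-identityʳ (W u))) le)

abstract
  -- Erasing the weight at one element of L lowers the total by at most 1. A row of the adjacency
  -- matrix as weight yields new neighbours, the constant 1 yields new vertices.
  escape : ∀ {m} (W : Vector m) → (∀ u → + 0 ℤ.≤ + 1 - W u) →
    ∀ L → + 0 ℤ.≤ sumFin W - + 1 - + length L → ∃ λ u → W u ≢ + 0 × All (u ≢_) L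
  escape W W≤1 [] heavy with Finₚ.any? (λ u → ¬? (W u ℤ.≟ + 0))
  ... | yes (u , Wu≢0) = u , Wu≢0 , []
  ... | no none = ⊥-elim (0≰negative heavy (cong (λ x → x - + 1 - + 0) (sumFin-zero zeros)))
    where
    zeros : ∀ u → W u ≡ + 0
    zeros u with W u ℤ.≟ + 0
    ... | yes e = e
    ... | no ne = contradiction (u , ne) none
  escape {m} W W≤1 (v ∷ L) heavy = u , W≢0 , u≢v ∷ u∉L
    where
    W′ : Vector m
    W′ u = W u - identity v u * W v
    W′v≡0 : W′ v ≡ + 0
    W′v≡0 = trans (cong (λ x → W v - x * W v) (identity-diag v)) (cancel (W v))
      where
      cancel : ∀ x → x - + 1 * x ≡ + 0
      cancel = solve-∀
    W′-off : ∀ {u} → v ≢ u → W′ u ≡ W u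
    W′-off {u} v≢u = trans (cong (λ x → W u - x * W v) (identity-off v≢u)) (ℤ.+-identityʳ (W u))
    W′≤1 : ∀ u → + 0 ℤ.≤ + 1 - W′ u
    W′≤1 u with v Finₚ.≟ u
    ... | yes refl = subst (λ x → + 0 ℤ.≤ + 1 - x) (sym W′v≡0) (ℤ.+≤+ ℕ.z≤n)
    ... | no v≢u   = subst (λ x → + 0 ℤ.≤ + 1 - x) (sym (W′-off v≢u)) (W≤1 u)
    weight : sumFin W′ ≡ sumFin W - W v
    weight = trans (sumFin-- W (λ u → identity v u * W v)) (cong (_-_ (sumFin W)) (sumFin-identity v (const (W v))))
    heavy′ : + 0 ℤ.≤ sumFin W′ - + 1 - + length L
    heavy′ = subst (+ 0 ℤ.≤_) (trans (regroup (sumFin W) (W v) (+ length L)) (cong (λ x → x - + 1 - + length L) (sym weight)))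
      (0≤+ heavy (W≤1 v))
      where
      regroup : ∀ s w l → s - + 1 - (+ 1 + l) + (+ 1 - w) ≡ s - w - + 1 - l
      regroup = solve-∀
    found : ∃ λ u → W′ u ≢ + 0 × All (u ≢_) L
    found = escape W′ W′≤1 L heavy′
    u : Fin m
    u = proj₁ found
    u∉L : All (u ≢_) L
    u∉L = proj₂ (proj₂ found)
    u≢v : u ≢ v
    u≢v u≡v = proj₁ (proj₂ found) (trans (cong W′ u≡v) W′v≡0)
    W≢0 : W u ≢ + 0
    W≢0 e = proj₁ (proj₂ found) (trans (W′-off (u≢v ∘ sym)) e)

  sum≡1 : ∀ {m} (W : Vector m) → (∀ u → + 0 ℤ.≤ W u) → sumFin W ≡ + 1 → ∃ λ v → ∀ u → W u ≡ identity v u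
  sum≡1 {m} W W≥0 total with Finₚ.any? (λ u → ¬? (W u ℤ.≟ + 0))
  ... | no none = contradiction (trans (sym total) (sumFin-zero zeros)) (λ ())
    where
    zeros : ∀ u → W u ≡ + 0
    zeros u with W u ℤ.≟ + 0
    ... | yes e = e
    ... | no ne = contradiction (u , ne) none
  ... | yes (v , Wv≢0) = v , λ u → ℤ.i-j≡0⇒i≡j (W u) (identity v u)
    (sumFin≡0⇒term≡0 (nonneg-off W≥0 (≢0⇒0≤-1 (W≥0 v) Wv≢0))
      (trans (sumFin-- W (identity v)) (cong₂ _-_ total (sum-identity v))) u)

-- Graphs

record Nbrs {m} (G : SimpleGraph m) (v a b : Fin m) : Set where
  field
    distinct : a ≢ b
    first    : adj G v a ≡ true
    second   : adj G v b ≡ true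
    only     : ∀ {u} → adj G v u ≡ true → u ≡ a ⊎ u ≡ b

-- Symmetry of adjacency makes u the second neighbour of w in turn, so the vertices other than h
-- fall into pairs.
Windmill : ∀ {m} → SimpleGraph m → Fin m → Set
Windmill G h = ∀ u → u ≢ h → ∃ λ w → Nbrs G u h w

module Adjacency {m} (G : SimpleGraph m) where

  private
    A : Matrix m
    A = adjMatrix G

  infix 4 _~_
  _~_ : Fin m → Fin m → Set
  u ~ v = adj G u v ≡ true

  _~?_ : ∀ u v → Dec (u ~ v)
  u ~? v = adj G u v Bool.≟ true

  A-sym : ∀ u v → A u v ≡ A v u
  A-sym u v = cong (if_then + 1 else + 0) (symm G u v)

  ~-sym : ∀ {u v} → u ~ v → v ~ u
  ~-sym {u} {v} u~v = trans (symm G v u) u~v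

  ~⇒≢ : ∀ {u v} → u ~ v → u ≢ v
  ~⇒≢ {u} u~v refl with trans (sym u~v) (irrfl G u)
  ... | ()

  A-yes : ∀ {u v} → u ~ v → A u v ≡ + 1
  A-yes u~v rewrite u~v = refl

  A-no : ∀ {u v} → ¬ u ~ v → A u v ≡ + 0
  A-no {u} {v} u≁v with adj G u v
  ... | true  = contradiction refl u≁v
  ... | false = refl

  A-diag : ∀ v → A v v ≡ + 0
  A-diag v rewrite irrfl G v = refl

  A≢0⇒~ : ∀ {u v} → A u v ≢ + 0 → u ~ v
  A≢0⇒~ {u} {v} A≢0 with adj G u v
  ... | true  = refl
  ... | false = contradiction refl A≢0

  A≡1⇒~ : ∀ {u v} → A u v ≡ + 1 → u ~ v
  A≡1⇒~ eq = A≢0⇒~ (λ e → contradiction (trans (sym eq) e) (λ ()))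

  A-nonneg : ∀ u v → + 0 ℤ.≤ A u v
  A-nonneg u v with adj G u v
  ... | true  = ℤ.+≤+ ℕ.z≤n
  ... | false = ℤ.+≤+ ℕ.z≤n

  A≤1 : ∀ u v → + 0 ℤ.≤ + 1 - A u v
  A≤1 u v with adj G u v
  ... | true  = ℤ.+≤+ ℕ.z≤n
  ... | false = ℤ.+≤+ ℕ.z≤n

  A-idempotent : ∀ u v → A u v * A u v ≡ A u v
  A-idempotent u v with adj G u v
  ... | true  = refl
  ... | false = refl

  degree : Fin m → ℤ
  degree v = sumFin (A v)

  length≤degree : ∀ v {L} → Unique L → All (v ~_) L → + 0 ℤ.≤ degree v - + length L
  length≤degree v unique nbrs = length≤weight (A v) (A-nonneg v) unique
    (All.map (λ v~u → ℤ.≤-reflexive (cong (_- + 1) (sym (A-yes v~u)))) nbrs)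

  another-neighbour : ∀ v L → + 0 ℤ.≤ degree v - + 1 - + length L → ∃ λ u → v ~ u × All (u ≢_) L
  another-neighbour v L le = let u , ne , u∉L = escape (A v) (A≤1 v) L le in u , A≢0⇒~ ne , u∉L

  closed⇒all : Connected G → (P : Fin m → Set) → ∀ {v} → P v → (∀ {u w} → P u → u ~ w → P w) → ∀ u → P u
  closed⇒all connected P {v} Pv close u = along (connected v u) Pv
    where
    along : ∀ {v u} → Reachable G v u → P v → P u
    along here         Pv = Pv
    along (step v~w r) Pv = along r (close Pv v~w)

  act-basis : ∀ v u → act A (identity v) u ≡ A u v
  act-basis v u = trans (sumFin-cong λ w → ℤ.*-comm (A u w) (identity v w)) (sumFin-identity v (A u))

  walk²-diag : ∀ v → iter A 2 (identity v) v ≡ degree v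
  walk²-diag v = sumFin-cong λ w → trans (cong (A v w *_) (trans (act-basis v w) (A-sym w v))) (A-idempotent v w)

  non-neighbours : Fin m → Vector m
  non-neighbours v u = + 1 - identity v u - A v u

  non-neighbours-nonneg : ∀ v u → + 0 ℤ.≤ non-neighbours v u
  non-neighbours-nonneg v u with v Finₚ.≟ u
  ... | yes refl = ℤ.≤-reflexive (sym (cong₂ (λ x y → + 1 - x - y) (identity-diag v) (A-diag v)))
  ... | no v≢u   = subst (λ x → + 0 ℤ.≤ + 1 - x - A v u) (sym (identity-off v≢u)) (A≤1 v u)

  non-neighbours-total : ∀ v → sumFin (non-neighbours v) ≡ + m - + 1 - degree v
  non-neighbours-total v = trans (sumFin-- (λ u → + 1 - identity v u) (A v))
    (cong (_- degree v) (trans (sumFin-- (const (+ 1)) (identity v))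
      (cong₂ _-_ (trans (sumFin-const m (+ 1)) (ℤ.*-identityʳ (+ m))) (sum-identity v))))

  dominating : ∀ {v} → degree v ≡ + m - + 1 → ∀ {u} → v ≢ u → v ~ u
  dominating {v} deg {u} v≢u = A≡1⇒~ (sym (ℤ.i-j≡0⇒i≡j (+ 1) (A v u) (trans
    (cong (λ e → + 1 - e - A v u) (sym (identity-off v≢u)))
    (sumFin≡0⇒term≡0 (non-neighbours-nonneg v)
      (trans (non-neighbours-total v) (trans (cong (_-_ (+ m - + 1)) deg) (ℤ.+-inverseʳ (+ m - + 1)))) u))))

  module _ {v a b} (nbrs : Nbrs G v a b) where
    open Nbrs nbrs

    Nbrs-swap : Nbrs G v b a
    Nbrs-swap = record { distinct = distinct ∘ sym ; first = second ; second = first ; only = Sum.swap ∘ only }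

    Nbrs-row : ∀ u → A v u ≡ identity a u + identity b u
    Nbrs-row u with a Finₚ.≟ u | b Finₚ.≟ u
    ... | yes refl | _        = trans (A-yes first) (sym (cong₂ _+_ (identity-diag a) (identity-off (distinct ∘ sym))))
    ... | no a≢u   | yes refl = trans (A-yes second) (sym (cong₂ _+_ (identity-off a≢u) (identity-diag b)))
    ... | no a≢u   | no b≢u   = trans (A-no λ v~u → Sum.[ a≢u ∘ sym , b≢u ∘ sym ] (only v~u))
      (sym (cong₂ _+_ (identity-off a≢u) (identity-off b≢u)))

    Nbrs-act : ∀ x → act A x v ≡ x a + x b
    Nbrs-act x = begin
      sumFin (λ u → A v u * x u)
        ≡⟨ sumFin-cong (λ u → trans (cong (_* x u) (Nbrs-row u)) (ℤ.*-distribʳ-+ (x u) (identity a u) (identity b u))) ⟩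
      sumFin (λ u → identity a u * x u + identity b u * x u)
        ≡⟨ sumFin-+ (λ u → identity a u * x u) (λ u → identity b u * x u) ⟩
      sumFin (λ u → identity a u * x u) + sumFin (λ u → identity b u * x u)
        ≡⟨ cong₂ _+_ (sumFin-identity a x) (sumFin-identity b x) ⟩
      x a + x b ∎

-- The classification for n ≥ 2

module Classification {m} (k : ℕ) (size : m ≡ 4 ℕ.+ k) (G : SimpleGraph m) (connected : Connected G)
  (annihilates : ∀ x u → quartic (adjMatrix G) (+ (3 ℕ.+ k)) x u ≡ + 0)
  (edges : trace (adjMatrix G) 2 ≡ + 3 * + (3 ℕ.+ k)) where

  open Adjacency G

  private
    V : Set
    V = Fin m
    A : Matrix m
    A = adjMatrix G
    N : ℤ
    N = + (3 ℕ.+ k)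
    size-N : + m ≡ + 1 + N
    size-N = cong +_ size

  open Semidefinite A A-sym k annihilates

  -- Off the diagonal gram counts common neighbours, and gram v v = degree v − 1; so a light vertex is one
  -- of degree 2.
  gram : V → V → ℤ
  gram u v = B (identity v) u

  gram-sym : ∀ u v → gram u v ≡ gram v u
  gram-sym u v = begin
    gram u v                           ≡⟨ sym (dot-identity u (B (identity v))) ⟩
    dot (identity u) (B (identity v))  ≡⟨ B-symmetric (identity u) (identity v) ⟩
    dot (B (identity u)) (identity v)  ≡⟨ dot-comm (B (identity u)) (identity v) ⟩
    dot (identity v) (B (identity u))  ≡⟨ dot-identity v (B (identity u)) ⟩
    gram v u                           ∎

  gram-act : ∀ u v → gram u v ≡ act A (λ w → A w v) u - identity v u
  gram-act u v = trans (B-def (identity v) u) (cong (_- identity v u) (act-cong A (act-basis v) u))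

  gram-diag : ∀ v → gram v v ≡ degree v - + 1
  gram-diag v = trans (B-def (identity v) v) (cong₂ _-_ (walk²-diag v) (identity-diag v))

  gram-off : ∀ {u v} → u ≢ v → gram u v ≡ sumFin (λ w → A u w * A w v)
  gram-off {u} {v} u≢v = trans (gram-act u v)
    (trans (cong (_-_ (act A (λ w → A w v) u)) (identity-off (u≢v ∘ sym))) (ℤ.+-identityʳ _))

  A*A-nonneg : ∀ u v w → + 0 ℤ.≤ A u w * A w v
  A*A-nonneg u v w with u ~? w
  ... | yes u~w rewrite A-yes u~w = subst (+ 0 ℤ.≤_) (sym (ℤ.*-identityˡ (A w v))) (A-nonneg w v)
  ... | no u≁w  rewrite A-no u≁w  = ℤ.≤-refl

  length≤gram : ∀ {u v} → u ≢ v → ∀ {L} → Unique L → All (λ w → u ~ w × w ~ v) L → + 0 ℤ.≤ gram u v - + length L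
  length≤gram {u} {v} u≢v {L} unique common = subst (λ g → + 0 ℤ.≤ g - + length L) (sym (gram-off u≢v))
    (length≤weight (λ w → A u w * A w v) (A*A-nonneg u v) unique
      (All.map (λ (u~w , w~v) → ℤ.≤-reflexive (sym (cong₂ (λ a b → a * b - + 1) (A-yes u~w) (A-yes w~v)))) common))

  gram-nonneg : ∀ {u v} → u ≢ v → + 0 ℤ.≤ gram u v
  gram-nonneg {u} {v} u≢v = subst (+ 0 ℤ.≤_) (sym (gram-off u≢v)) (sumFin-nonneg (A*A-nonneg u v))

  common⇒gram≢0 : ∀ {u v w} → u ≢ v → u ~ w → w ~ v → gram u v ≢ + 0
  common⇒gram≢0 u≢v u~w w~v eq =
    0≰negative (length≤gram u≢v ([] ∷ []) ((u~w , w~v) ∷ [])) (cong (_- + 1) eq)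

  pair : ℤ → ℤ → V → V → Vector m
  pair a b u v w = a * identity u w + b * identity v w

  B-pair : ∀ a b u v w → B (pair a b u v) w ≡ a * gram w u + b * gram w v
  B-pair a b u v w = B-combine a b (identity u) (identity v) w

  dot-pair : ∀ a b u v y → dot (pair a b u v) y ≡ a * y u + b * y v
  dot-pair a b u v y = begin
    dot (pair a b u v) y
      ≡⟨ trans (dot-comm (pair a b u v) y) (dot-combine a b y (identity u) (identity v)) ⟩
    a * dot y (identity u) + b * dot y (identity v)
      ≡⟨ cong₂ (λ p q → a * p + b * q) (basis u) (basis v) ⟩
    a * y u + b * y v ∎
    where
    basis : ∀ w → dot y (identity w) ≡ y w
    basis w = trans (dot-comm y (identity w)) (dot-identity w y)

  form-pair : ∀ a b u v → dot (pair a b u v) (B (pair a b u v)) ≡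
    a * (a * gram u u + b * gram u v) + b * (a * gram u v + b * gram v v)
  form-pair a b u v = trans (dot-pair a b u v (B (pair a b u v))) (cong₂ (λ p q → a * p + b * q)
    (B-pair a b u v u) (trans (B-pair a b u v v) (cong (λ g → a * g + b * gram v v) (gram-sym v u))))

  sum-one : sumFin {m} (const (+ 1)) ≡ + 1 + N
  sum-one = trans (sumFin-const m (+ 1)) (trans (ℤ.*-identityʳ (+ m)) size-N)

  fresh : ∀ L → + 0 ℤ.≤ + (3 ℕ.+ k) - + length L → ∃ λ (u : V) → All (u ≢_) L
  fresh L le = let u , _ , u∉L = escape {m} (const (+ 1)) (λ _ → ℤ.≤-refl) L
                     (subst (λ s → + 0 ℤ.≤ s - + 1 - + length L) (sym sum-one) le)
               in u , u∉L

  neighbour : ∀ v → ∃ λ w → v ~ w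
  neighbour v with fresh (v ∷ []) (ℤ.+≤+ ℕ.z≤n)
  ... | u , u≢v ∷ [] with connected v u
  ...   | here         = contradiction refl u≢v
  ...   | step v~w _   = _ , v~w

  gram-diag-nonneg : ∀ v → + 0 ℤ.≤ gram v v
  gram-diag-nonneg v = subst (+ 0 ℤ.≤_) (sym (gram-diag v))
    (length≤degree v ([] ∷ []) (proj₂ (neighbour v) ∷ []))

  -- If v has degree 1, its neighbour has no other neighbour, since B e_v = 0.
  gram-diag≢0 : ∀ v → gram v v ≢ + 0
  gram-diag≢0 v eq with neighbour v
  ... | w , v~w = outside (fresh (v ∷ w ∷ []) (ℤ.+≤+ ℕ.z≤n))
    where
    orthogonal : ∀ u → gram u v ≡ + 0
    orthogonal = B-definite (identity v) (trans (dot-identity v (B (identity v))) eq)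
    only-v : ∀ {u} → w ~ u → u ≡ v
    only-v {u} w~u with u Finₚ.≟ v
    ... | yes u≡v = u≡v
    ... | no u≢v  = contradiction (orthogonal u) (common⇒gram≢0 u≢v (~-sym w~u) (~-sym v~w))
    only-w : ∀ {u} → v ~ u → u ≡ w
    only-w {u} v~u with u Finₚ.≟ w
    ... | yes u≡w = u≡w
    ... | no u≢w  = ⊥-elim (0≰negative (length≤degree v ((u≢w ∷ []) ∷ [] ∷ []) (v~u ∷ v~w ∷ []))
      (trans (shift (degree v)) (cong (_- + 1) (trans (sym (gram-diag v)) eq))))
      where
      shift : ∀ d → d - + 2 ≡ d - + 1 - + 1
      shift = solve-∀
    outside : (∃ λ u → All (u ≢_) (v ∷ w ∷ [])) → ⊥
    outside (u , u≢v ∷ u≢w ∷ []) with closed⇒all connected (λ u → u ≡ v ⊎ u ≡ w) (inj₁ refl)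
      (λ { (inj₁ refl) v~x → inj₂ (only-w v~x) ; (inj₂ refl) w~x → inj₁ (only-v w~x) }) u
    ... | inj₁ e = u≢v e
    ... | inj₂ e = u≢w e

  Light : V → Set
  Light v = gram v v ≡ + 1

  light? : ∀ v → Dec (Light v)
  light? v = gram v v ℤ.≟ + 1

  gram-positive : ∀ v → + 0 ℤ.≤ gram v v - + 1
  gram-positive v = ≢0⇒0≤-1 (gram-diag-nonneg v) (gram-diag≢0 v)

  heavy : ∀ {v} → ¬ Light v → + 0 ℤ.≤ gram v v - + 2
  heavy {v} ¬light = subst (+ 0 ℤ.≤_) (shift (gram v v))
    (≢0⇒0≤-1 (gram-positive v) (¬light ∘ ℤ.i-j≡0⇒i≡j (gram v v) (+ 1)))
    where
    shift : ∀ g → g - + 1 - + 1 ≡ g - + 2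
    shift = solve-∀

  total : sumFin (λ v → gram v v) ≡ N + N - + 1
  total = begin
    sumFin (λ v → gram v v)
      ≡⟨ trans (sumFin-cong λ v → B-def (identity v) v) (sumFin-- (λ v → iter A 2 (identity v) v) (λ v → identity v v)) ⟩
    trace A 2 - sumFin {m} (λ v → identity v v)
      ≡⟨ cong₂ _-_ edges (trans (sumFin-cong {m} identity-diag) sum-one) ⟩
    + 3 * N - (+ 1 + N)
      ≡⟨ simplify N ⟩
    N + N - + 1 ∎
    where
    simplify : ∀ N → + 3 * N - (+ 1 + N) ≡ N + N - + 1
    simplify = solve-∀

  deficit : sumFin (λ v → gram v v - + 2) ≡ - + 3
  deficit = trans (sumFin-- (λ v → gram v v) (const (+ 2)))
    (trans (cong₂ _-_ total (trans (sumFin-const m (+ 2)) (cong (_* + 2) size-N))) (simplify N))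
    where
    simplify : ∀ N → N + N - + 1 - (+ 1 + N) * + 2 ≡ - + 3
    simplify = solve-∀

  -- A discharging tool: the excesses gram v v - 2 are -1 at light vertices, nonnegative elsewhere,
  -- and sum to -3. Charges that lift every vertex to 0 or more must total at least 3.
  compensation : ∀ c → (∀ v → + 0 ℤ.≤ gram v v - + 2 + c v) → + 0 ℤ.≤ sumFin c - + 3
  compensation c le = subst (+ 0 ℤ.≤_)
    (trans (sumFin-+ (λ v → gram v v - + 2) c) (trans (cong (_+ sumFin c) deficit) (ℤ.+-comm (- + 3) (sumFin c))))
    (sumFin-nonneg le)

  degree-of-light : ∀ {v} → Light v → degree v ≡ + 2
  degree-of-light {v} light = trans (shift (degree v)) (cong (_+ + 1) (trans (sym (gram-diag v)) light))
    where
    shift : ∀ d → d ≡ d - + 1 + + 1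
    shift = solve-∀

  light-nbrs : ∀ {v a b} → Light v → v ~ a → v ~ b → a ≢ b → Nbrs G v a b
  light-nbrs {v} {a} {b} light v~a v~b a≢b = record { distinct = a≢b ; first = v~a ; second = v~b ; only = only }
    where
    only : ∀ {u} → v ~ u → u ≡ a ⊎ u ≡ b
    only {u} v~u with u Finₚ.≟ a | u Finₚ.≟ b
    ... | yes e  | _      = inj₁ e
    ... | no _   | yes e  = inj₂ e
    ... | no u≢a | no u≢b = ⊥-elim (0≰negative
      (length≤degree v ((u≢a ∷ u≢b ∷ []) ∷ (a≢b ∷ []) ∷ [] ∷ []) (v~u ∷ v~a ∷ v~b ∷ []))
      (cong (_- + 3) (degree-of-light light)))

  light-other : ∀ {v a} → Light v → v ~ a → ∃ λ b → Nbrs G v a b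
  light-other {v} {a} light v~a
    with b , v~b , b≢a ∷ [] ← another-neighbour v (a ∷ [])
           (ℤ.≤-reflexive (sym (cong (λ d → d - + 1 - + 1) (degree-of-light light))))
    = b , light-nbrs light v~a v~b (b≢a ∘ sym)

  module _ {v a b} (nbrs : Nbrs G v a b) where
    open Nbrs nbrs

    Nbrs-gram : ∀ u → gram v u ≡ A a u + A b u - identity u v
    Nbrs-gram u = trans (gram-act v u) (cong (_- identity u v) (Nbrs-act nbrs (λ w → A w u)))

    Nbrs-gram-off : ∀ {u} → v ≢ u → gram v u ≡ A a u + A b u
    Nbrs-gram-off {u} v≢u = trans (Nbrs-gram u)
      (trans (cong (_-_ (A a u + A b u)) (identity-off (v≢u ∘ sym))) (ℤ.+-identityʳ _))

    Nbrs-gram-first : gram v a ≡ A b a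
    Nbrs-gram-first = trans (Nbrs-gram-off (~⇒≢ first)) (trans (cong (_+ A b a) (A-diag a)) (ℤ.+-identityˡ (A b a)))

    Nbrs-gram-second : gram v b ≡ A a b
    Nbrs-gram-second = trans (Nbrs-gram-off (~⇒≢ second)) (trans (cong (_+_ (A a b)) (A-diag b)) (ℤ.+-identityʳ (A a b)))

    -- B commutes with A, and A maps e_v to e_a + e_b.
    B-act-light : ∀ u → act A (B (identity v)) u ≡ gram u a + gram u b
    B-act-light u = begin
      act A (B (identity v)) u
        ≡⟨ sym (B-act (identity v) u) ⟩
      B (act A (identity v)) u
        ≡⟨ B-cong (λ w → trans (act-basis v w) (trans (A-sym w v) (row w))) u ⟩
      B (pair (+ 1) (+ 1) a b) u
        ≡⟨ B-pair (+ 1) (+ 1) a b u ⟩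
      + 1 * gram u a + + 1 * gram u b
        ≡⟨ cong₂ _+_ (ℤ.*-identityˡ (gram u a)) (ℤ.*-identityˡ (gram u b)) ⟩
      gram u a + gram u b ∎
      where
      row : ∀ w → A v w ≡ pair (+ 1) (+ 1) a b w
      row w = trans (Nbrs-row nbrs w) (sym (cong₂ _+_ (ℤ.*-identityˡ (identity a w)) (ℤ.*-identityˡ (identity b w))))

    -- B² = A B + (N - 1) B. The diagonal entry of A B at v is gram v a + gram v b, and both
    -- summands record whether a ~ b.
    square-of-light : gram v v ≡ + 1 → dot (B (identity v)) (B (identity v)) ≡ A a b + A a b + (N - + 1)
    square-of-light light = begin
      dot (B (identity v)) (B (identity v))
        ≡⟨ B-square (identity v) ⟩
      dot (identity v) (act A (B (identity v))) + (N - + 1) * dot (identity v) (B (identity v))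
        ≡⟨ cong₂ (λ p q → p + (N - + 1) * q)
             (trans (dot-identity v (act A (B (identity v)))) (trans (B-act-light v) (cong₂ _+_
               (trans Nbrs-gram-first (A-sym b a)) Nbrs-gram-second)))
             (trans (dot-identity v (B (identity v))) light) ⟩
      A a b + A a b + (N - + 1) * + 1
        ≡⟨ cong (_+_ (A a b + A a b)) (ℤ.*-identityʳ (N - + 1)) ⟩
      A a b + A a b + (N - + 1) ∎

  light-pair : ∀ {v} → Light v → ∃ λ a → ∃ λ b → Nbrs G v a b
  light-pair {v} light = let a , v~a = neighbour v in a , light-other light v~a

  -- Two light vertices v , v′ with gram v v′ = 0. The Gram matrix of the residuals of all the e_u with
  -- respect to e_v , e_v′ has nonnegative diagonal and trace 1 − 2[a ~ b] − 2[a′ ~ b′], so it is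
  -- a single diagonal unit at some vertex c. Then e_c lies in the image of B, which makes c
  -- adjacent to every other vertex, v and v′ included.
  module Orthogonal {v v′ a b a′ b′} (nbrs : Nbrs G v a b) (nbrs′ : Nbrs G v′ a′ b′)
    (light : Light v) (light′ : Light v′) (v≢v′ : v ≢ v′) (orthogonal : gram v v′ ≡ + 0) where

    abstract
      -- A Gram-Schmidt step for the form ⟨x , B y⟩, in which e_v and e_v′ are orthonormal.
      residual : V → Vector m
      residual u w = + 1 * (+ 1 * identity u w + - gram u v * identity v w) + - gram u v′ * identity v′ w

      B-residual : ∀ u w → B (residual u) w ≡ gram w u - gram u v * gram w v - gram u v′ * gram w v′
      B-residual u w = begin
        B (residual u) w
          ≡⟨ B-combine (+ 1) (- gram u v′) (pair (+ 1) (- gram u v) u v) (identity v′) w ⟩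
        + 1 * B (pair (+ 1) (- gram u v) u v) w + - gram u v′ * gram w v′
          ≡⟨ cong (λ x → + 1 * x + - gram u v′ * gram w v′) (B-pair (+ 1) (- gram u v) u v w) ⟩
        + 1 * (+ 1 * gram w u + - gram u v * gram w v) + - gram u v′ * gram w v′
          ≡⟨ regroup (gram w u) (gram u v) (gram w v) (gram u v′) (gram w v′) ⟩
        gram w u - gram u v * gram w v - gram u v′ * gram w v′ ∎
        where
        regroup : ∀ g p q p′ q′ → + 1 * (+ 1 * g + - p * q) + - p′ * q′ ≡ g - p * q - p′ * q′
        regroup = solve-∀

      B-residual-v : ∀ u → B (residual u) v ≡ + 0
      B-residual-v u = begin
        B (residual u) v
          ≡⟨ B-residual u v ⟩
        gram v u - gram u v * gram v v - gram u v′ * gram v v′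
          ≡⟨ cong₂ (λ x y → gram v u - gram u v * x - gram u v′ * y) light orthogonal ⟩
        gram v u - gram u v * + 1 - gram u v′ * + 0
          ≡⟨ cong (λ x → x - gram u v * + 1 - gram u v′ * + 0) (gram-sym v u) ⟩
        gram u v - gram u v * + 1 - gram u v′ * + 0
          ≡⟨ cancel (gram u v) (gram u v′) ⟩
        + 0 ∎
        where
        cancel : ∀ p q → p - p * + 1 - q * + 0 ≡ + 0
        cancel = solve-∀

      B-residual-v′ : ∀ u → B (residual u) v′ ≡ + 0
      B-residual-v′ u = begin
        B (residual u) v′
          ≡⟨ B-residual u v′ ⟩
        gram v′ u - gram u v * gram v′ v - gram u v′ * gram v′ v′
          ≡⟨ cong₂ (λ x y → gram v′ u - gram u v * x - gram u v′ * y) (trans (gram-sym v′ v) orthogonal) light′ ⟩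
        gram v′ u - gram u v * + 0 - gram u v′ * + 1
          ≡⟨ cong (λ x → x - gram u v * + 0 - gram u v′ * + 1) (gram-sym v′ u) ⟩
        gram u v′ - gram u v * + 0 - gram u v′ * + 1
          ≡⟨ cancel (gram u v) (gram u v′) ⟩
        + 0 ∎
        where
        cancel : ∀ p q → q - p * + 0 - q * + 1 ≡ + 0
        cancel = solve-∀

      form-residual : ∀ u → dot (residual u) (B (residual u)) ≡ B (residual u) u
      form-residual u = begin
        dot (residual u) y
          ≡⟨ trans (dot-comm (residual u) y) (dot-combine (+ 1) (- gram u v′) y (pair (+ 1) (- gram u v) u v) (identity v′)) ⟩
        + 1 * dot y (pair (+ 1) (- gram u v) u v) + - gram u v′ * dot y (identity v′)
          ≡⟨ cong₂ (λ p q → + 1 * p + - gram u v′ * q)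
               (trans (dot-comm y (pair (+ 1) (- gram u v) u v)) (dot-pair (+ 1) (- gram u v) u v y))
               (trans (dot-comm y (identity v′)) (trans (dot-identity v′ y) (B-residual-v′ u))) ⟩
        + 1 * (+ 1 * y u + - gram u v * y v) + - gram u v′ * + 0
          ≡⟨ cong (λ x → + 1 * (+ 1 * y u + - gram u v * x) + - gram u v′ * + 0) (B-residual-v u) ⟩
        + 1 * (+ 1 * y u + - gram u v * + 0) + - gram u v′ * + 0
          ≡⟨ simplify (y u) (gram u v) (gram u v′) ⟩
        y u ∎
        where
        y : Vector m
        y = B (residual u)
        simplify : ∀ y p q → + 1 * (+ 1 * y + - p * + 0) + - q * + 0 ≡ y
        simplify = solve-∀

    R : Vector m
    R u = B (residual u) u

    R-nonneg : ∀ u → + 0 ℤ.≤ R u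
    R-nonneg u = subst (+ 0 ℤ.≤_) (form-residual u) (B-nonneg (residual u))

    R-total : sumFin R ≡ + 1 - (A a b + A a b) - (A a′ b′ + A a′ b′)
    R-total = begin
      sumFin R
        ≡⟨ sumFin-cong (λ u → B-residual u u) ⟩
      sumFin (λ u → gram u u - gram u v * gram u v - gram u v′ * gram u v′)
        ≡⟨ trans (sumFin-- (λ u → gram u u - gram u v * gram u v) (λ u → gram u v′ * gram u v′))
             (cong (_- dot (B (identity v′)) (B (identity v′))) (sumFin-- (λ u → gram u u) (λ u → gram u v * gram u v))) ⟩
      sumFin (λ u → gram u u) - dot (B (identity v)) (B (identity v)) - dot (B (identity v′)) (B (identity v′))
        ≡⟨ cong₂ _-_ (cong₂ _-_ total (square-of-light nbrs light)) (square-of-light nbrs′ light′) ⟩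
      N + N - + 1 - (A a b + A a b + (N - + 1)) - (A a′ b′ + A a′ b′ + (N - + 1))
        ≡⟨ regroup N (A a b) (A a′ b′) ⟩
      + 1 - (A a b + A a b) - (A a′ b′ + A a′ b′) ∎
      where
      regroup : ∀ N x y → N + N - + 1 - (x + x + (N - + 1)) - (y + y + (N - + 1)) ≡ + 1 - (x + x) - (y + y)
      regroup = solve-∀

    -- The total is nonnegative, which excludes both a ~ b and a′ ~ b′.
    R-total≡1 : sumFin R ≡ + 1
    R-total≡1 = cases (a ~? b) (a′ ~? b′)
      where
      nonneg : + 0 ℤ.≤ + 1 - (A a b + A a b) - (A a′ b′ + A a′ b′)
      nonneg = subst (+ 0 ℤ.≤_) R-total (sumFin-nonneg R-nonneg)
      cancel : ∀ y → + 1 - (+ 1 + + 1) - (y + y) + (y + y) ≡ - + 1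
      cancel = solve-∀
      cases : Dec (a ~ b) → Dec (a′ ~ b′) → sumFin R ≡ + 1
      cases (yes a~b) _ = ⊥-elim (0≰negative (0≤+ nonneg (0≤+ (A-nonneg a′ b′) (A-nonneg a′ b′)))
        (trans (cong (λ x → + 1 - (x + x) - (A a′ b′ + A a′ b′) + (A a′ b′ + A a′ b′)) (A-yes a~b)) (cancel (A a′ b′))))
      cases (no a≁b) (yes a′~b′) = ⊥-elim (0≰negative nonneg
        (cong₂ (λ x y → + 1 - (x + x) - (y + y)) (A-no a≁b) (A-yes a′~b′)))
      cases (no a≁b) (no a′≁b′) = trans R-total (cong₂ (λ x y → + 1 - (x + x) - (y + y)) (A-no a≁b) (A-no a′≁b′))

    abstract
      c : V
      c = proj₁ (sum≡1 R R-nonneg R-total≡1)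

      R≡identity : ∀ u → R u ≡ identity c u
      R≡identity = proj₂ (sum≡1 R R-nonneg R-total≡1)

    -- For w ≠ c the form vanishes at `residual w`, hence so does B (residual w); symmetry turns its
    -- entry at c into the entry of B (residual c) at w.
    B-residual-c : ∀ w → B (residual c) w ≡ identity c w
    B-residual-c w with w Finₚ.≟ c
    ... | yes refl = R≡identity w
    ... | no w≢c = begin
      B (residual c) w
        ≡⟨ B-residual c w ⟩
      gram w c - gram c v * gram w v - gram c v′ * gram w v′
        ≡⟨ trans (cong (λ x → x - gram c v * gram w v - gram c v′ * gram w v′) (gram-sym w c))
             (commute (gram c w) (gram c v) (gram w v) (gram c v′) (gram w v′)) ⟩
      gram c w - gram w v * gram c v - gram w v′ * gram c v′
        ≡⟨ sym (B-residual w c) ⟩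
      B (residual w) c
        ≡⟨ B-definite (residual w) (trans (form-residual w) (trans (R≡identity w) (identity-off (w≢c ∘ sym)))) c ⟩
      + 0
        ≡⟨ sym (identity-off (w≢c ∘ sym)) ⟩
      identity c w ∎
      where
      commute : ∀ g p q p′ q′ → g - p * q - p′ * q′ ≡ g - q * p - q′ * p′
      commute = solve-∀

    -- Since e_c is in the image of B, A² e_c = A e_c + N e_c; the degree is the entry at c.
    degree-c : degree c ≡ N
    degree-c = begin
      degree c
        ≡⟨ shift (degree c) ⟩
      degree c - + 1 + + 1
        ≡⟨ cong₂ _+_ (trans (sym (gram-diag c)) (B-def (identity c) c)) (sym (identity-diag c)) ⟩
      iter A 2 (identity c) c - identity c c + identity c c
        ≡⟨ restore (iter A 2 (identity c) c) (identity c c) ⟩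
      iter A 2 (identity c) c
        ≡⟨ act-cong A (act-cong A (sym ∘ B-residual-c)) c ⟩
      iter A 2 (B (residual c)) c
        ≡⟨ B-eigen (residual c) c ⟩
      act A (B (residual c)) c + N * B (residual c) c
        ≡⟨ cong₂ (λ x y → x + N * y)
             (trans (act-cong A B-residual-c c) (trans (act-basis c c) (A-diag c)))
             (trans (B-residual-c c) (identity-diag c)) ⟩
      + 0 + N * + 1
        ≡⟨ trans (ℤ.+-identityˡ (N * + 1)) (ℤ.*-identityʳ N) ⟩
      N ∎
      where
      shift : ∀ d → d ≡ d - + 1 + + 1
      shift = solve-∀
      restore : ∀ x y → x - y + y ≡ x
      restore = solve-∀

    c-adjacent : ∀ {w} → w ≢ c → c ~ w
    c-adjacent = dominating (trans degree-c (trans (shift N) (cong (_- + 1) (sym size-N)))) ∘ (_∘ sym)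
      where
      shift : ∀ N → N ≡ + 1 + N - + 1
      shift = solve-∀

    impossible : ⊥
    impossible = common⇒gram≢0 v≢v′ (~-sym (c-adjacent v≢c)) (c-adjacent v′≢c) orthogonal
      where
      v≢c : v ≢ c
      v≢c e = contradiction (trans (sym (trans (cong (identity c) e) (identity-diag c))) (trans (sym (R≡identity v)) (B-residual-v v))) (λ ())
      v′≢c : v′ ≢ c
      v′≢c e = contradiction (trans (sym (trans (cong (identity c) e) (identity-diag c))) (trans (sym (R≡identity v′)) (B-residual-v′ v′))) (λ ())

  -- The form at e_v - e_v′ is 2 - 2 gram v v′, so the entry is at most 1; it is a nonnegative
  -- integer, and `Orthogonal.impossible` excludes 0.
  light-gram : ∀ {v v′} → Light v → Light v′ → v ≢ v′ → gram v v′ ≡ + 1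
  light-gram {v} {v′} light light′ v≢v′ with gram v v′ ℤ.≟ + 1
  ... | yes e = e
  ... | no ne = ⊥-elim (0≰negative (0≤+ difference (0≤+ excess excess)) (cancel (gram v v′)))
    where
    nonzero : gram v v′ ≢ + 0
    nonzero = let _ , _ , nbrs = light-pair light ; _ , _ , nbrs′ = light-pair light′
              in Orthogonal.impossible nbrs nbrs′ light light′ v≢v′
    excess : + 0 ℤ.≤ gram v v′ - + 1 - + 1
    excess = ≢0⇒0≤-1 (≢0⇒0≤-1 (gram-nonneg v≢v′) nonzero) (ne ∘ ℤ.i-j≡0⇒i≡j (gram v v′) (+ 1))
    difference : + 0 ℤ.≤ + 1 * (+ 1 * + 1 + ℤ.-1ℤ * gram v v′) + ℤ.-1ℤ * (+ 1 * gram v v′ + ℤ.-1ℤ * + 1)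
    difference = subst (+ 0 ℤ.≤_) (trans (form-pair (+ 1) ℤ.-1ℤ v v′)
      (cong₂ (λ x y → + 1 * (+ 1 * x + ℤ.-1ℤ * gram v v′) + ℤ.-1ℤ * (+ 1 * gram v v′ + ℤ.-1ℤ * y)) light light′))
      (B-nonneg (pair (+ 1) ℤ.-1ℤ v v′))
    cancel : ∀ g → + 1 * (+ 1 * + 1 + ℤ.-1ℤ * g) + ℤ.-1ℤ * (+ 1 * g + ℤ.-1ℤ * + 1) + (g - + 1 - + 1 + (g - + 1 - + 1)) ≡ - + 2
    cancel = solve-∀

  -- The form at e_v - e_v′ is 1 - 2 + 1 = 0, so B annihilates this vector.
  light-twins : ∀ {v v′} → Light v → Light v′ → ∀ u → gram u v ≡ gram u v′
  light-twins {v} {v′} light light′ u with v Finₚ.≟ v′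
  ... | yes refl = refl
  ... | no v≢v′ = ℤ.i-j≡0⇒i≡j (gram u v) (gram u v′) (begin
    gram u v - gram u v′
      ≡⟨ expand (gram u v) (gram u v′) ⟩
    + 1 * gram u v + ℤ.-1ℤ * gram u v′
      ≡⟨ sym (B-pair (+ 1) ℤ.-1ℤ v v′ u) ⟩
    B (pair (+ 1) ℤ.-1ℤ v v′) u
      ≡⟨ B-definite (pair (+ 1) ℤ.-1ℤ v v′) (trans (form-pair (+ 1) ℤ.-1ℤ v v′) vanish) u ⟩
    + 0 ∎)
    where
    expand : ∀ x y → x - y ≡ + 1 * x + ℤ.-1ℤ * y
    expand = solve-∀
    vanish : + 1 * (+ 1 * gram v v + ℤ.-1ℤ * gram v v′) + ℤ.-1ℤ * (+ 1 * gram v v′ + ℤ.-1ℤ * gram v′ v′) ≡ + 0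
    vanish rewrite light | light′ | light-gram light light′ v≢v′ = refl

  -- B A e_v = B A e_v′ when B e_v = B e_v′.
  light-twins-act : ∀ {v v′ a b a′ b′} → Light v → Light v′ → Nbrs G v a b → Nbrs G v′ a′ b′ →
    ∀ u → gram u a + gram u b ≡ gram u a′ + gram u b′
  light-twins-act light light′ nbrs nbrs′ u =
    trans (sym (B-act-light nbrs u)) (trans (act-cong A (light-twins light light′) u) (B-act-light nbrs′ u))

  -- Since gram x x = degree x - 1, the hypothesis says that all neighbours of x but one are
  -- neighbours of y, and v is the exception.
  shared-neighbour : ∀ {x y v z} → x ≢ y → gram x x ≡ gram x y → x ~ v → ¬ v ~ y → x ~ z → z ≢ v → z ~ y
  shared-neighbour {x} {y} {v} {z} x≢y eq x~v v≁y x~z z≢v with z ~? y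
  ... | yes z~y = z~y
  ... | no z≁y  = ⊥-elim (0≰negative (length≤weight W W-nonneg ((z≢v ∷ []) ∷ [] ∷ []) (unit x~z z≁y ∷ unit x~v v≁y ∷ []))
    (cong (_- + 2) W-total))
    where
    W : Vector m
    W w = A x w - A x w * A w y
    W-nonneg : ∀ w → + 0 ℤ.≤ W w
    W-nonneg w with x ~? w
    ... | yes x~w rewrite A-yes x~w = subst (λ a → + 0 ℤ.≤ + 1 - a) (sym (ℤ.*-identityˡ (A w y))) (A≤1 w y)
    ... | no x≁w  rewrite A-no x≁w  = ℤ.≤-refl
    unit : ∀ {w} → x ~ w → ¬ w ~ y → + 0 ℤ.≤ W w - + 1
    unit x~w w≁y = ℤ.≤-reflexive (sym (cong₂ (λ a b → a - a * b - + 1) (A-yes x~w) (A-no w≁y)))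
    W-total : sumFin W ≡ + 1
    W-total = begin
      sumFin W
        ≡⟨ sumFin-- (A x) (λ w → A x w * A w y) ⟩
      degree x - sumFin (λ w → A x w * A w y)
        ≡⟨ cong (_-_ (degree x)) (trans (sym (gram-off x≢y)) (trans (sym eq) (gram-diag x))) ⟩
      degree x - (degree x - + 1)
        ≡⟨ cancel (degree x) ⟩
      + 1 ∎
      where
      cancel : ∀ d → d - (d - + 1) ≡ + 1
      cancel = solve-∀

  exactly-one : ∀ u v w → A u w + A v w ≡ + 1 → (u ~ w × ¬ v ~ w) ⊎ (v ~ w × ¬ u ~ w)
  exactly-one u v w eq with adj G u w | adj G v w
  ... | true  | false = inj₁ (refl , λ ())
  ... | false | true  = inj₂ (refl , λ ())
  ... | true  | true  = contradiction eq (λ ())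
  ... | false | false = contradiction eq (λ ())

  only-neighbour : ∀ {u v w} → A u w + A v w ≡ + 1 → ¬ u ~ w → v ~ w
  only-neighbour {u} {v} {w} eq u≁w with exactly-one u v w eq
  ... | inj₁ (u~w , _) = contradiction u~w u≁w
  ... | inj₂ (v~w , _) = v~w

  -- Compare the equal rows of v and v′ at a: both count the possible edge between a and b, and only
  -- the row of v′ has the further terms A c a - [a = v′].
  corner : ∀ {v v′ a b c} → Light v → Light v′ → Nbrs G v a b → Nbrs G v′ b c → A c a ≡ identity a v′
  corner {v} {v′} {a} {b} {c} light light′ nbrs nbrs′ = begin
    A c a
      ≡⟨ isolate (A b a) (A c a) (identity a v′) ⟩
    A b a + A c a - identity a v′ - A b a + identity a v′
      ≡⟨ cong (λ x → x - A b a + identity a v′) (trans (sym (Nbrs-gram nbrs′ a)) (gram-sym v′ a)) ⟩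
    gram a v′ - A b a + identity a v′
      ≡⟨ cong (λ x → x - A b a + identity a v′)
           (trans (light-twins light′ light a) (trans (gram-sym a v) (Nbrs-gram-first nbrs))) ⟩
    A b a - A b a + identity a v′
      ≡⟨ cancel (A b a) (identity a v′) ⟩
    identity a v′ ∎
    where
    isolate : ∀ x y e → y ≡ x + y - e - x + e
    isolate = solve-∀
    cancel : ∀ x e → x - x + e ≡ e
    cancel = solve-∀

  identity≡1⇒≡ : ∀ {i j : V} → identity i j ≡ + 1 → i ≡ j
  identity≡1⇒≡ {i} {j} eq with i Finₚ.≟ j
  ... | yes e = e
  ... | no ne = contradiction (trans (sym eq) (identity-off ne)) (λ ())

  Nbrs-omits : ∀ {v a b w} → Nbrs G v a b → w ≢ a → w ≢ b → ¬ v ~ w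
  Nbrs-omits nbrs w≢a w≢b v~w = Sum.[ w≢a , w≢b ] (Nbrs.only nbrs v~w)

  not-K₃ : ∀ {x y z} → Nbrs G x y z → Nbrs G y x z → Nbrs G z x y → ⊥
  not-K₃ {x} {y} {z} nx ny nz =
    let u , u∉xyz = fresh (x ∷ y ∷ z ∷ []) (ℤ.+≤+ ℕ.z≤n)
    in All.lookup u∉xyz (member (closed⇒all connected (λ u → u ≡ x ⊎ u ≡ y ⊎ u ≡ z) (inj₁ refl) close u)) refl
    where
    member : ∀ {u} → u ≡ x ⊎ u ≡ y ⊎ u ≡ z → u ∈ x ∷ y ∷ z ∷ []
    member (inj₁ e)        = here e
    member (inj₂ (inj₁ e)) = there (here e)
    member (inj₂ (inj₂ e)) = there (there (here e))
    close : ∀ {u w} → u ≡ x ⊎ u ≡ y ⊎ u ≡ z → u ~ w → w ≡ x ⊎ w ≡ y ⊎ w ≡ z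
    close (inj₁ refl)        u~w = inj₂ (Nbrs.only nx u~w)
    close (inj₂ (inj₁ refl)) u~w = Sum.map₂ inj₂ (Nbrs.only ny u~w)
    close (inj₂ (inj₂ refl)) u~w = Sum.map₂ inj₁ (Nbrs.only nz u~w)

  -- If v₁ , v₂ , v₃ are light with neighbourhoods {a , b} , {a , c} , {b , c}, then either they form
  -- a component K₃ or a further neighbour z of a is adjacent to b, so that gram z v₁ = 2 makes
  -- gram z z too large for the total.
  module Triangle {v₁ v₂ v₃ a b c} (light₁ : Light v₁) (light₂ : Light v₂) (light₃ : Light v₃)
    (nbrs₁ : Nbrs G v₁ a b) (nbrs₂ : Nbrs G v₂ a c) (nbrs₃ : Nbrs G v₃ b c) where

    a≢b : a ≢ b
    a≢b = Nbrs.distinct nbrs₁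

    A-ab : A a b ≡ identity a v₃
    A-ab = trans (A-sym a b) (corner light₂ light₃ nbrs₂ (Nbrs-swap nbrs₃))

    b-v₂ : identity b v₂ ≡ identity a v₃
    b-v₂ = trans (sym (corner light₃ light₂ nbrs₃ (Nbrs-swap nbrs₂))) A-ab

    c-v₁ : identity c v₁ ≡ identity a v₃
    c-v₁ = begin
      identity c v₁  ≡⟨ sym (corner light₂ light₁ (Nbrs-swap nbrs₂) nbrs₁) ⟩
      A b c          ≡⟨ A-sym b c ⟩
      A c b          ≡⟨ corner light₁ light₂ (Nbrs-swap nbrs₁) nbrs₂ ⟩
      identity b v₂  ≡⟨ b-v₂ ⟩
      identity a v₃  ∎

    a≢v₃ : a ≢ v₃
    a≢v₃ a≡v₃ = not-K₃ (subst₂ (Nbrs G v₃) b≡v₂ c≡v₁ nbrs₃) (subst₂ (Nbrs G v₂) a≡v₃ c≡v₁ nbrs₂)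
      (subst₂ (Nbrs G v₁) a≡v₃ b≡v₂ nbrs₁)
      where
      unit : identity a v₃ ≡ + 1
      unit = trans (cong (identity a) (sym a≡v₃)) (identity-diag a)
      b≡v₂ : b ≡ v₂
      b≡v₂ = identity≡1⇒≡ (trans b-v₂ unit)
      c≡v₁ : c ≡ v₁
      c≡v₁ = identity≡1⇒≡ (trans c-v₁ unit)

    -- Comparing v₁ with v₂ gives gram a b = gram a c; comparing v₁ with v₃ gives gram a a = gram a
    -- c.
    gram-ab : gram a b ≡ gram a a
    gram-ab = trans (+-cancelˡ (gram a a) (gram a b) (gram a c) (light-twins-act light₁ light₂ nbrs₁ nbrs₂ a))
      (sym (+-cancelˡ (gram a b) (gram a a) (gram a c)
        (trans (ℤ.+-comm (gram a b) (gram a a)) (light-twins-act light₁ light₃ nbrs₁ nbrs₃ a))))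

    -- A light a would have gram v₁ a = 1, but this entry is A b a, which is 0 once a ≠ v₃.
    heavy-a : + 0 ℤ.≤ gram a a - + 2
    heavy-a = heavy λ light → contradiction
      (trans (sym (light-gram light₁ light (~⇒≢ (Nbrs.first nbrs₁))))
        (trans (Nbrs-gram-first nbrs₁) (trans (A-sym b a) (trans A-ab (identity-off a≢v₃)))))
      (λ ())

    abstract
      further : ∃ λ z → a ~ z × All (z ≢_) (v₁ ∷ v₂ ∷ [])
      further = another-neighbour a (v₁ ∷ v₂ ∷ []) (subst (+ 0 ℤ.≤_) (cong (_- + 2) (gram-diag a)) heavy-a)

    z : V
    z = proj₁ further

    a~z : a ~ z
    a~z = proj₁ (proj₂ further)

    z≢v₁ : z ≢ v₁
    z≢v₁ = All.head (proj₂ (proj₂ further))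

    z≢v₂ : z ≢ v₂
    z≢v₂ = All.head (All.tail (proj₂ (proj₂ further)))

    z~b : z ~ b
    z~b = shared-neighbour a≢b (sym gram-ab) (~-sym (Nbrs.first nbrs₂))
      (Nbrs-omits nbrs₂ (a≢b ∘ sym) (Nbrs.distinct nbrs₃)) a~z z≢v₂

    gram-z-v₁ : gram z v₁ ≡ + 2
    gram-z-v₁ = trans (gram-sym z v₁) (trans (Nbrs-gram-off nbrs₁ (z≢v₁ ∘ sym)) (cong₂ _+_ (A-yes a~z) (A-yes (~-sym z~b))))

    -- Cauchy-Schwarz with the unit vector at v₁, that is, the form at e_z - 2 e_v₁.
    very-heavy-z : + 0 ℤ.≤ gram z z - + 4
    very-heavy-z = subst (+ 0 ℤ.≤_) (trans (form-pair (+ 1) (- + 2) z v₁) (trans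
      (cong₂ (λ x y → + 1 * (+ 1 * gram z z + - + 2 * x) + - + 2 * (+ 1 * x + - + 2 * y)) gram-z-v₁ light₁)
      (simplify (gram z z)))) (B-nonneg (pair (+ 1) (- + 2) z v₁))
      where
      simplify : ∀ g → + 1 * (+ 1 * g + - + 2 * + 2) + - + 2 * (+ 1 * + 2 + - + 2 * + 1) ≡ g - + 4
      simplify = solve-∀

    only-three : ∀ {u} → Light u → u ≡ v₁ ⊎ u ≡ v₂ ⊎ u ≡ v₃
    only-three {u} light with u Finₚ.≟ v₁ | u Finₚ.≟ v₂ | u Finₚ.≟ v₃
    ... | yes e  | _      | _     = inj₁ e
    ... | no _   | yes e  | _     = inj₂ (inj₁ e)
    ... | no _   | no _   | yes e = inj₂ (inj₂ e)
    ... | no ≢v₁ | no ≢v₂ | no ≢v₃ = ⊥-elim (parity (meets light₁ nbrs₁ ≢v₁) (meets light₂ nbrs₂ ≢v₂) (meets light₃ nbrs₃ ≢v₃))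
      where
      meets : ∀ {v x y} → Light v → Nbrs G v x y → u ≢ v → A x u + A y u ≡ + 1
      meets lightᵥ nbrs u≢v = trans (sym (Nbrs-gram-off nbrs (u≢v ∘ sym))) (light-gram lightᵥ light (u≢v ∘ sym))
      -- The three equations add up to 2 (A a u + A b u + A c u) = 3.
      parity : A a u + A b u ≡ + 1 → A a u + A c u ≡ + 1 → A b u + A c u ≡ + 1 → ⊥
      parity with adj G a u | adj G b u | adj G c u
      ... | true  | true  | _     = λ ()
      ... | true  | false | true  = λ _ ()
      ... | true  | false | false = λ _ _ ()
      ... | false | true  | true  = λ _ _ ()
      ... | false | true  | false = λ _ ()
      ... | false | false | _     = λ ()

    -- A charge of 1 at each vᵢ covers all light vertices, and z, with excess at least 2, can give
    -- back 2. The total charge is then 1 instead of the required 3.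
    three charge : Vector m
    three u = identity v₁ u + identity v₂ u + identity v₃ u
    charge u = three u - + 2 * identity z u

    three-nonneg : ∀ u → + 0 ℤ.≤ three u
    three-nonneg u = 0≤+ (0≤+ (identity-nonneg v₁ u) (identity-nonneg v₂ u)) (identity-nonneg v₃ u)

    three-light : ∀ u → Light u → + 0 ℤ.≤ gram u u - + 2 + three u
    three-light u light = subst (λ g → + 0 ℤ.≤ g - + 2 + three u) (sym light) (positive (only-three light))
      where
      first : ∀ x y → x + y ≡ ℤ.-1ℤ + (+ 1 + x + y)
      first = solve-∀
      second : ∀ x y → x + y ≡ ℤ.-1ℤ + (x + + 1 + y)
      second = solve-∀
      third : ∀ x y → x + y ≡ ℤ.-1ℤ + (x + y + + 1)
      third = solve-∀
      positive : u ≡ v₁ ⊎ u ≡ v₂ ⊎ u ≡ v₃ → + 0 ℤ.≤ ℤ.-1ℤ + three u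
      positive (inj₁ refl) = subst (λ e → + 0 ℤ.≤ ℤ.-1ℤ + (e + identity v₂ u + identity v₃ u)) (sym (identity-diag u))
        (subst (+ 0 ℤ.≤_) (first (identity v₂ u) (identity v₃ u)) (0≤+ (identity-nonneg v₂ u) (identity-nonneg v₃ u)))
      positive (inj₂ (inj₁ refl)) = subst (λ e → + 0 ℤ.≤ ℤ.-1ℤ + (identity v₁ u + e + identity v₃ u)) (sym (identity-diag u))
        (subst (+ 0 ℤ.≤_) (second (identity v₁ u) (identity v₃ u)) (0≤+ (identity-nonneg v₁ u) (identity-nonneg v₃ u)))
      positive (inj₂ (inj₂ refl)) = subst (λ e → + 0 ℤ.≤ ℤ.-1ℤ + (identity v₁ u + identity v₂ u + e)) (sym (identity-diag u))
        (subst (+ 0 ℤ.≤_) (third (identity v₁ u) (identity v₂ u)) (0≤+ (identity-nonneg v₁ u) (identity-nonneg v₂ u)))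

    charge-nonneg : ∀ u → + 0 ℤ.≤ gram u u - + 2 + charge u
    charge-nonneg u with z Finₚ.≟ u
    ... | yes refl = subst (+ 0 ℤ.≤_) (trans (regroup (gram z z) (three z))
        (cong (λ e → gram z z - + 2 + (three z - + 2 * e)) (sym (identity-diag z)))) (0≤+ very-heavy-z (three-nonneg z))
      where
      regroup : ∀ g t → g - + 4 + t ≡ g - + 2 + (t - + 2 * + 1)
      regroup = solve-∀
    ... | no z≢u = subst (λ e → + 0 ℤ.≤ gram u u - + 2 + (three u - + 2 * e)) (sym (identity-off z≢u))
        (subst (+ 0 ℤ.≤_) (drop (gram u u) (three u)) without-z)
      where
      drop : ∀ g t → g - + 2 + t ≡ g - + 2 + (t - + 2 * + 0)
      drop = solve-∀
      without-z : + 0 ℤ.≤ gram u u - + 2 + three u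
      without-z with light? u
      ... | yes light = three-light u light
      ... | no ¬light = 0≤+ (heavy ¬light) (three-nonneg u)

    charge-total : sumFin charge ≡ + 1
    charge-total = trans (sumFin-- three (λ u → + 2 * identity z u)) (cong₂ _-_
      (trans (sumFin-+ (λ u → identity v₁ u + identity v₂ u) (identity v₃)) (cong₂ _+_
        (trans (sumFin-+ (identity v₁) (identity v₂)) (cong₂ _+_ (sum-identity v₁) (sum-identity v₂))) (sum-identity v₃)))
      (trans (sumFin-*ˡ (+ 2) (identity z)) (cong (+ 2 *_) (sum-identity z))))

    impossible : ⊥
    impossible = 0≰negative (compensation charge charge-nonneg) (cong (_- + 3) charge-total)

  -- Since Σ_u (gram u u − 2) = −3, the light vertices have to be exactly the neighbours of h, and all
  -- other vertices but h have degree 3.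
  module Star {h : V} (adjacent : ∀ {u} → Light u → u ~ h)
    {v₁ v₂ w₁ w₂} (light₁ : Light v₁) (light₂ : Light v₂) (v₁≢v₂ : v₁ ≢ v₂)
    (nbrs₁ : Nbrs G v₁ h w₁) (nbrs₂ : Nbrs G v₂ h w₂) where

    -- The last term cancels the excess degree h - 3 at h itself. The excesses sum to -3 and the
    -- edges at h to degree h, so the total is 0 and every entry must vanish.
    slack : Vector m
    slack u = gram u u - + 2 + A u h - (degree h - + 3) * identity h u

    slack-nonneg : ∀ u → + 0 ℤ.≤ slack u
    slack-nonneg u with h Finₚ.≟ u
    ... | yes refl = ℤ.≤-reflexive (sym (trans
        (cong₂ (λ x y → x - + 2 + y - (degree h - + 3) * identity h h) (gram-diag h) (A-diag h))
        (trans (cong (λ e → degree h - + 1 - + 2 + + 0 - (degree h - + 3) * e) (identity-diag h)) (cancel (degree h)))))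
      where
      cancel : ∀ d → d - + 1 - + 2 + + 0 - (d - + 3) * + 1 ≡ + 0
      cancel = solve-∀
    ... | no h≢u = subst (λ e → + 0 ℤ.≤ gram u u - + 2 + A u h - (degree h - + 3) * e) (sym (identity-off h≢u))
        (subst (+ 0 ℤ.≤_) (drop (gram u u) (A u h) (degree h)) without-h)
      where
      drop : ∀ g a d → g - + 2 + a ≡ g - + 2 + a - (d - + 3) * + 0
      drop = solve-∀
      without-h : + 0 ℤ.≤ gram u u - + 2 + A u h
      without-h with light? u
      ... | yes light = ℤ.≤-reflexive (sym (cong₂ (λ x y → x - + 2 + y) light (A-yes (adjacent light))))
      ... | no ¬light = 0≤+ (heavy ¬light) (A-nonneg u h)

    slack-total : sumFin slack ≡ + 0
    slack-total = begin
      sumFin slack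
        ≡⟨ sumFin-- (λ u → gram u u - + 2 + A u h) (λ u → (degree h - + 3) * identity h u) ⟩
      sumFin (λ u → gram u u - + 2 + A u h) - sumFin (λ u → (degree h - + 3) * identity h u)
        ≡⟨ cong₂ _-_ (trans (sumFin-+ (λ u → gram u u - + 2) (λ u → A u h)) (cong₂ _+_ deficit (sumFin-cong λ u → A-sym u h)))
             (trans (sumFin-*ˡ (degree h - + 3) (identity h)) (cong ((degree h - + 3) *_) (sum-identity h))) ⟩
      - + 3 + degree h - (degree h - + 3) * + 1
        ≡⟨ cancel (degree h) ⟩
      + 0 ∎
      where
      cancel : ∀ d → - + 3 + d - (d - + 3) * + 1 ≡ + 0
      cancel = solve-∀

    gram-star : ∀ {u} → u ≢ h → gram u u ≡ + 2 - A u h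
    gram-star {u} u≢h = begin
      gram u u
        ≡⟨ isolate (gram u u) (A u h) (degree h) ⟩
      gram u u - + 2 + A u h - (degree h - + 3) * + 0 + (+ 2 - A u h)
        ≡⟨ cong (λ e → gram u u - + 2 + A u h - (degree h - + 3) * e + (+ 2 - A u h)) (sym (identity-off (u≢h ∘ sym))) ⟩
      slack u + (+ 2 - A u h)
        ≡⟨ cong (_+ (+ 2 - A u h)) (sumFin≡0⇒term≡0 slack-nonneg slack-total u) ⟩
      + 0 + (+ 2 - A u h)
        ≡⟨ ℤ.+-identityˡ (+ 2 - A u h) ⟩
      + 2 - A u h ∎
      where
      isolate : ∀ g a d → g ≡ g - + 2 + a - (d - + 3) * + 0 + (+ 2 - a)
      isolate = solve-∀

    neighbour-light : ∀ {u} → u ~ h → Light u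
    neighbour-light u~h = trans (gram-star (~⇒≢ u~h)) (cong (_-_ (+ 2)) (A-yes u~h))

    -- For every neighbour u of h with second neighbour w, gram u h is A w h; as twins share this
    -- value, w ~ h follows from w₁ ~ h. So h and its neighbours form a component.
    windmill : w₁ ~ h → Windmill G h
    windmill w₁~h u u≢h = Sum.[ (λ u≡h → contradiction u≡h u≢h) , (λ u~h → light-other (neighbour-light u~h) u~h) ]
      (closed⇒all connected (λ u → u ≡ h ⊎ u ~ h) (inj₁ refl) close u)
      where
      end~h : ∀ {u w} → u ~ h → Nbrs G u h w → w ~ h
      end~h {u} {w} u~h nbrs = A≡1⇒~ (begin
        A w h      ≡⟨ sym (Nbrs-gram-first nbrs) ⟩
        gram u h   ≡⟨ gram-sym u h ⟩
        gram h u   ≡⟨ light-twins (neighbour-light u~h) light₁ h ⟩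
        gram h v₁  ≡⟨ gram-sym h v₁ ⟩
        gram v₁ h  ≡⟨ Nbrs-gram-first nbrs₁ ⟩
        A w₁ h     ≡⟨ A-yes w₁~h ⟩
        + 1        ∎)
      close : ∀ {u w} → u ≡ h ⊎ u ~ h → u ~ w → w ≡ h ⊎ w ~ h
      close (inj₁ refl) h~w = inj₂ (~-sym h~w)
      close (inj₂ u~h)  u~w =
        let _ , nbrs = light-other (neighbour-light u~h) u~h
        in Sum.map₂ (λ w≡end → subst (_~ h) (sym w≡end) (end~h u~h nbrs)) (Nbrs.only nbrs u~w)

    -- A common end, in addition to h, would make gram v v′ = 2.
    ends-distinct : ∀ {v v′ w w′} → Light v → Light v′ → v ≢ v′ → Nbrs G v h w → Nbrs G v′ h w′ → w ≢ w′
    ends-distinct {v} {v′} light light′ v≢v′ nbrs nbrs′ refl = contradiction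
      (trans (sym (light-gram light light′ v≢v′)) (trans (Nbrs-gram-off nbrs v≢v′)
        (cong₂ _+_ (A-yes (~-sym (Nbrs.first nbrs′))) (A-yes (~-sym (Nbrs.second nbrs′))))))
      (λ ())

    -- If w₁ is not adjacent to h, three light vertices v₁ , v₂ , v₃ have further neighbours w₁ , w₂ , w₃
    -- with three neighbours each, two of which, z and z′, are shared; then gram z z′ > 2.
    module _ (w₁≁h : ¬ w₁ ~ h) where

      abstract
        -- h is not light, for then it would be adjacent to itself; so it has degree at least 3.
        third : ∃ λ v → h ~ v × All (v ≢_) (v₁ ∷ v₂ ∷ [])
        third = another-neighbour h (v₁ ∷ v₂ ∷ [])
          (subst (+ 0 ℤ.≤_) (cong (_- + 2) (gram-diag h)) (heavy λ light → ~⇒≢ (adjacent light) refl))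

      w₁≢h : w₁ ≢ h
      w₁≢h = Nbrs.distinct nbrs₁ ∘ sym

      gram-w₁ : gram w₁ w₁ ≡ + 2
      gram-w₁ = trans (gram-star w₁≢h) (cong (_-_ (+ 2)) (A-no w₁≁h))

      degree-w₁ : degree w₁ ≡ + 3
      degree-w₁ = trans (shift (degree w₁)) (cong (_+ + 1) (trans (sym (gram-diag w₁)) gram-w₁))
        where
        shift : ∀ d → d ≡ d - + 1 + + 1
        shift = solve-∀

      -- As v₁ and v are twins with the common neighbour h, the entries at w₁ give gram w₁ w₁ = gram
      -- w₁ w; v₁ is the one neighbour of w₁ that w lacks.
      shared : ∀ {v w z} → Light v → v₁ ≢ v → Nbrs G v h w → w₁ ~ z → z ≢ v₁ → z ~ w
      shared {v} {w} light v₁≢v nbrs w₁~z z≢v₁ = shared-neighbour w₁≢w gram-eq (~-sym (Nbrs.second nbrs₁))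
        (Nbrs-omits nbrs₁ (Nbrs.distinct nbrs ∘ sym) (w₁≢w ∘ sym)) w₁~z z≢v₁
        where
        w₁≢w : w₁ ≢ w
        w₁≢w = ends-distinct light₁ light v₁≢v nbrs₁ nbrs
        gram-eq : gram w₁ w₁ ≡ gram w₁ w
        gram-eq = +-cancelˡ (gram w₁ h) (gram w₁ w₁) (gram w₁ w) (light-twins-act light₁ light nbrs₁ nbrs w₁)

      away : ∀ {z} → w₁ ~ z → z ≢ h
      away w₁~z refl = w₁≁h w₁~z

      -- The form at e_z - e_z′ would be at most 2 + 2 - 2 · 3, since w₁, w₂ and w₃ are common
      -- neighbours.
      crowded : ∀ {v₃ w₃ z z′} → Light v₃ → v₁ ≢ v₃ → v₂ ≢ v₃ → Nbrs G v₃ h w₃ →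
        w₁ ~ z → z ≢ v₁ → w₁ ~ z′ → z′ ≢ v₁ → z ≢ z′ → ⊥
      crowded {v₃} {w₃} {z} {z′} light₃ v₁≢v₃ v₂≢v₃ nbrs₃ w₁~z z≢v₁ w₁~z′ z′≢v₁ z≢z′ =
        0≰negative (0≤+ (0≤+ difference (0≤+ common common)) (0≤+ (A-nonneg z h) (A-nonneg z′ h)))
          (trans (cong₂ (λ x y → + 1 * (+ 1 * x + ℤ.-1ℤ * gram z z′) + ℤ.-1ℤ * (+ 1 * gram z z′ + ℤ.-1ℤ * y)
              + (gram z z′ - + 3 + (gram z z′ - + 3)) + (A z h + A z′ h))
            (gram-star (away w₁~z)) (gram-star (away w₁~z′))) (cancel (gram z z′) (A z h) (A z′ h)))
        where
        common : + 0 ℤ.≤ gram z z′ - + 3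
        common = length≤gram z≢z′
          ((ends-distinct light₁ light₂ v₁≢v₂ nbrs₁ nbrs₂ ∷ ends-distinct light₁ light₃ v₁≢v₃ nbrs₁ nbrs₃ ∷ [])
            ∷ (ends-distinct light₂ light₃ v₂≢v₃ nbrs₂ nbrs₃ ∷ []) ∷ [] ∷ [])
          ((~-sym w₁~z , w₁~z′)
            ∷ (shared light₂ v₁≢v₂ nbrs₂ w₁~z z≢v₁ , ~-sym (shared light₂ v₁≢v₂ nbrs₂ w₁~z′ z′≢v₁))
            ∷ (shared light₃ v₁≢v₃ nbrs₃ w₁~z z≢v₁ , ~-sym (shared light₃ v₁≢v₃ nbrs₃ w₁~z′ z′≢v₁)) ∷ [])
        difference : + 0 ℤ.≤ + 1 * (+ 1 * gram z z + ℤ.-1ℤ * gram z z′) + ℤ.-1ℤ * (+ 1 * gram z z′ + ℤ.-1ℤ * gram z′ z′)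
        difference = subst (+ 0 ℤ.≤_) (form-pair (+ 1) ℤ.-1ℤ z z′) (B-nonneg (pair (+ 1) ℤ.-1ℤ z z′))
        cancel : ∀ g x y → + 1 * (+ 1 * (+ 2 - x) + ℤ.-1ℤ * g) + ℤ.-1ℤ * (+ 1 * g + ℤ.-1ℤ * (+ 2 - y))
          + (g - + 3 + (g - + 3)) + (x + y) ≡ - + 2
        cancel = solve-∀

      impossible : ⊥
      impossible =
        let v₃ , h~v₃ , v₃∉ = third
            light₃ = neighbour-light (~-sym h~v₃)
            w₃ , nbrs₃ = light-other light₃ (~-sym h~v₃)
            z , w₁~z , z∉ = another-neighbour w₁ (v₁ ∷ []) (subst (λ d → + 0 ℤ.≤ d - + 1 - + 1) (sym degree-w₁) (ℤ.+≤+ ℕ.z≤n))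
            z′ , w₁~z′ , z′∉ = another-neighbour w₁ (v₁ ∷ z ∷ []) (subst (λ d → + 0 ℤ.≤ d - + 1 - + 2) (sym degree-w₁) (ℤ.+≤+ ℕ.z≤n))
        in crowded light₃ (All.head v₃∉ ∘ sym) (All.head (All.tail v₃∉) ∘ sym) nbrs₃
             w₁~z (All.head z∉) w₁~z′ (All.head z′∉) (All.head (All.tail z′∉) ∘ sym)

  -- With at most one light vertex, a total charge of at most 1 would suffice in `compensation`.
  light-vertices : ∃ λ v₁ → ∃ λ v₂ → Light v₁ × Light v₂ × v₁ ≢ v₂
  light-vertices = first (Finₚ.any? light?)
    where
    compensated : ∀ {v₁} → Light v₁ → ¬ (∃ λ u → Light u × v₁ ≢ u) → ∀ u → + 0 ℤ.≤ gram u u - + 2 + identity v₁ u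
    compensated {v₁} light₁ none u = cases (v₁ Finₚ.≟ u)
      where
      cases : Dec (v₁ ≡ u) → + 0 ℤ.≤ gram u u - + 2 + identity v₁ u
      cases (yes refl) = ℤ.≤-reflexive (sym (cong₂ (λ x y → x - + 2 + y) light₁ (identity-diag v₁)))
      cases (no v₁≢u)  = 0≤+ (heavy λ light → none (u , light , v₁≢u)) (identity-nonneg v₁ u)
    second : ∀ {v₁} → Light v₁ → Dec (∃ λ u → Light u × v₁ ≢ u) → ∃ λ v₁ → ∃ λ v₂ → Light v₁ × Light v₂ × v₁ ≢ v₂
    second {v₁} light₁ (yes (v₂ , light₂ , v₁≢v₂)) = v₁ , v₂ , light₁ , light₂ , v₁≢v₂
    second {v₁} light₁ (no none) = ⊥-elim (0≰negative
      (compensation (identity v₁) (compensated light₁ none)) (cong (_- + 3) (sum-identity v₁)))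
    first : Dec (∃ Light) → ∃ λ v₁ → ∃ λ v₂ → Light v₁ × Light v₂ × v₁ ≢ v₂
    first (yes (v₁ , light₁)) = second light₁ (Finₚ.any? (λ u → light? u ×-dec ¬? (v₁ Finₚ.≟ u)))
    first (no none) = ⊥-elim (0≰negative
      (compensation (const (+ 0)) λ u → subst (+ 0 ℤ.≤_) (sym (ℤ.+-identityʳ (gram u u - + 2))) (heavy (none ∘ (u ,_))))
      (cong (_- + 3) (sumFin-zero {f = λ (u : V) → + 0} λ _ → refl)))

  -- A light vertex not adjacent to h has to share w₁ with v₁ and w₂ with v₂, which closes the
  -- triangle of neighbourhoods; w₁ ≠ w₂ because only w₂ is adjacent to v₂. If there is none, the
  -- neighbourhoods form a star.
  from-common-neighbour : ∀ {v₁ v₂ h w₁ w₂} → Light v₁ → Light v₂ → v₁ ≢ v₂ → Nbrs G v₁ h w₁ → Nbrs G v₂ h w₂ →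
    ¬ w₁ ~ v₂ → ∃ λ h → Windmill G h
  from-common-neighbour {v₁} {v₂} {h} {w₁} {w₂} light₁ light₂ v₁≢v₂ nbrs₁ nbrs₂ w₁≁v₂ =
    cases (Finₚ.any? (λ u → light? u ×-dec ¬? (u ~? h)))
    where
    meets : ∀ {v v₃ w} → Light v → Light v₃ → ¬ v₃ ~ h → Nbrs G v h w → v₃ ~ w
    meets {v} {v₃} light light₃ v₃≁h nbrs = ~-sym (only-neighbour
      (trans (sym (Nbrs-gram-off nbrs v≢v₃)) (light-gram light light₃ v≢v₃)) (v₃≁h ∘ ~-sym))
      where
      v≢v₃ : v ≢ v₃
      v≢v₃ refl = v₃≁h (Nbrs.first nbrs)
    star : (∀ {u} → Light u → u ~ h) → Dec (w₁ ~ h) → ∃ λ h → Windmill G h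
    star adjacent (yes w₁~h) = h , Star.windmill adjacent light₁ light₂ v₁≢v₂ nbrs₁ nbrs₂ w₁~h
    star adjacent (no w₁≁h)  = ⊥-elim (Star.impossible adjacent light₁ light₂ v₁≢v₂ nbrs₁ nbrs₂ w₁≁h)
    cases : Dec (∃ λ u → Light u × ¬ u ~ h) → ∃ λ h → Windmill G h
    cases (yes (v₃ , light₃ , v₃≁h)) = ⊥-elim (Triangle.impossible light₁ light₂ light₃ nbrs₁ nbrs₂
      (light-nbrs light₃ (meets light₁ light₃ v₃≁h nbrs₁) (meets light₂ light₃ v₃≁h nbrs₂)
        (λ w₁≡w₂ → w₁≁v₂ (subst (_~ v₂) (sym w₁≡w₂) (~-sym (Nbrs.second nbrs₂))))))
    cases (no none) = star (λ {u} light → decidable-stable (u ~? h) (λ u≁h → none (u , light , u≁h))) (w₁ ~? h)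

  windmill : ∃ λ h → Windmill G h
  windmill =
    let v₁ , v₂ , light₁ , light₂ , v₁≢v₂ = light-vertices
        a , b , nbrs = light-pair light₁
    in Sum.[ (λ (a~v₂ , b≁v₂) → from-common-neighbour light₁ light₂ v₁≢v₂ nbrs (proj₂ (light-other light₂ (~-sym a~v₂))) b≁v₂)
           , (λ (b~v₂ , a≁v₂) → from-common-neighbour light₁ light₂ v₁≢v₂ (Nbrs-swap nbrs) (proj₂ (light-other light₂ (~-sym b~v₂))) a≁v₂)
           ] (exactly-one a b v₂ (trans (sym (Nbrs-gram-off nbrs v₁≢v₂)) (light-gram light₁ light₂ v₁≢v₂)))

-- Isomorphism with the friendship graph

-- Pigeonhole: punching out a missed value would embed `Fin (suc m)` into `Fin m`.
injective⇒inverse : ∀ {m} (f : Fin m → Fin m) → (∀ {i j} → f i ≡ f j → i ≡ j) → ∀ v → ∃ λ i → f i ≡ v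
injective⇒inverse {suc m} f injective v with Finₚ.any? (λ i → f i Finₚ.≟ v)
... | yes found = found
... | no missed = contradiction
  (Finₚ.injective⇒≤ {f = λ i → Fin.punchOut (avoids i)} (injective ∘ Finₚ.punchOut-injective (avoids _) (avoids _)))
  ℕ.1+n≰n
  where
  avoids : ∀ i → v ≢ f i
  avoids i e = missed (i , sym e)

module _ (n : ℕ) (G : SimpleGraph (suc (n ℕ.+ n))) (h : Fin (suc (n ℕ.+ n))) (windmill : Windmill G h) where

  open Adjacency G

  private
    V : Set
    V = Fin (suc (n ℕ.+ n))

    mate : V → V
    mate u with u Finₚ.≟ h
    ... | yes _  = h
    ... | no u≢h = proj₁ (windmill u u≢h)

    mate-h : mate h ≡ h
    mate-h with h Finₚ.≟ h
    ... | yes _  = refl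
    ... | no h≢h = contradiction refl h≢h

    mate-nbrs : ∀ {u} → u ≢ h → Nbrs G u h (mate u)
    mate-nbrs {u} u≢h with u Finₚ.≟ h
    ... | yes u≡h  = contradiction u≡h u≢h
    ... | no u≢h′ = proj₂ (windmill u u≢h′)

    mate-≢h : ∀ {u} → u ≢ h → mate u ≢ h
    mate-≢h u≢h = Nbrs.distinct (mate-nbrs u≢h) ∘ sym

    mate-involutive : ∀ u → mate (mate u) ≡ u
    mate-involutive u = cases (u Finₚ.≟ h)
      where
      cases : Dec (u ≡ h) → mate (mate u) ≡ u
      cases (yes refl) = trans (cong mate mate-h) mate-h
      cases (no u≢h)   = Sum.[ (λ u≡h → contradiction u≡h u≢h) , sym ]
        (Nbrs.only (mate-nbrs (mate-≢h u≢h)) (~-sym (Nbrs.second (mate-nbrs u≢h))))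

    -- The list L holds one vertex of each triangle; beyond its end, vertex L takes the junk value h.
    vertex : List V → ℕ → V
    vertex []      _             = h
    vertex (a ∷ L) zero          = a
    vertex (a ∷ L) (suc zero)    = mate a
    vertex (a ∷ L) (suc (suc i)) = vertex L i

    vertex-flip : ∀ L i → vertex L (flip i) ≡ mate (vertex L i)
    vertex-flip []      i             = sym mate-h
    vertex-flip (a ∷ L) zero          = refl
    vertex-flip (a ∷ L) (suc zero)    = sym (mate-involutive a)
    vertex-flip (a ∷ L) (suc (suc i)) = vertex-flip L i

    -- Only a itself is required to be new; by `vertex-≢mate` so is its mate. The condition for all
    -- i is harmless past the end, where it repeats a ≢ h.
    data Transversal : ℕ → List V → Set where
      []  : Transversal 0 []
      add : ∀ {j a L} → a ≢ h → (∀ i → vertex L i ≢ a) → Transversal j L → Transversal (suc j) (a ∷ L)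

    vertex-≢mate : ∀ {a} L → (∀ i → vertex L i ≢ a) → ∀ i → vertex L i ≢ mate a
    vertex-≢mate {a} L avoids i e = avoids (flip i) (trans (vertex-flip L i) (trans (cong mate e) (mate-involutive a)))

    shrink : ∀ {i j} → suc (suc i) ℕ.< suc j ℕ.+ suc j → i ℕ.< j ℕ.+ j
    shrink {i} {j} (ℕ.s≤s h) with subst (suc (suc i) ℕ.≤_) (ℕ.+-suc j j) h
    ... | ℕ.s≤s i<2j = i<2j

    vertex-≢h : ∀ {j L} → Transversal j L → ∀ i → i ℕ.< j ℕ.+ j → vertex L i ≢ h
    vertex-≢h (add a≢h _ _) zero          _ = a≢h
    vertex-≢h (add a≢h _ _) (suc zero)    _ = mate-≢h a≢h
    vertex-≢h (add _ _ tr)  (suc (suc i)) i< = vertex-≢h tr i (shrink i<)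

    vertex-injective : ∀ {j L} → Transversal j L → ∀ i i′ → i ℕ.< j ℕ.+ j → i′ ℕ.< j ℕ.+ j →
      vertex L i ≡ vertex L i′ → i ≡ i′
    vertex-injective _ zero zero _ _ _ = refl
    vertex-injective (add a≢h _ _) zero (suc zero) _ _ e = contradiction e (~⇒≢ (Nbrs.second (mate-nbrs a≢h)))
    vertex-injective (add _ avoids _) zero (suc (suc i′)) _ _ e = contradiction (sym e) (avoids i′)
    vertex-injective (add a≢h _ _) (suc zero) zero _ _ e = contradiction (sym e) (~⇒≢ (Nbrs.second (mate-nbrs a≢h)))
    vertex-injective _ (suc zero) (suc zero) _ _ _ = refl
    vertex-injective {L = _ ∷ L} (add _ avoids _) (suc zero) (suc (suc i′)) _ _ e = contradiction (sym e) (vertex-≢mate L avoids i′)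
    vertex-injective (add _ avoids _) (suc (suc i)) zero _ _ e = contradiction e (avoids i)
    vertex-injective {L = _ ∷ L} (add _ avoids _) (suc (suc i)) (suc zero) _ _ e = contradiction e (vertex-≢mate L avoids i)
    vertex-injective (add _ _ tr) (suc (suc i)) (suc (suc i′)) i< i′< e =
      cong (λ i → suc (suc i)) (vertex-injective tr i i′ (shrink i<) (shrink i′<) e)

    covered : List V → List V
    covered []      = h ∷ []
    covered (a ∷ L) = a ∷ mate a ∷ covered L

    avoid-covered : ∀ {a} L → All (a ≢_) (covered L) → a ≢ h × (∀ i → vertex L i ≢ a)
    avoid-covered [] (a≢h ∷ []) = a≢h , λ _ → a≢h ∘ sym
    avoid-covered {a} (b ∷ L) (a≢b ∷ a≢mate ∷ rest) = proj₁ (avoid-covered L rest) , avoids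
      where
      avoids : ∀ i → vertex (b ∷ L) i ≢ a
      avoids zero          = a≢b ∘ sym
      avoids (suc zero)    = a≢mate ∘ sym
      avoids (suc (suc i)) = proj₂ (avoid-covered L rest) i

    length-covered : ∀ {j L} → Transversal j L → length (covered L) ≡ suc (j ℕ.+ j)
    length-covered []                     = refl
    length-covered (add {j} _ _ tr) = cong (λ l → suc (suc l)) (trans (length-covered tr) (sym (ℕ.+-suc j j)))

    extend : ∀ {j L} → j ℕ.< n → Transversal j L → ∃ (Transversal (suc j))
    extend {j} {L} j<n tr =
      let a , _ , a∉L = escape {suc (n ℕ.+ n)} (const (+ 1)) (λ _ → ℤ.≤-refl) (covered L) room
      in a ∷ L , add (proj₁ (avoid-covered L a∉L)) (proj₂ (avoid-covered L a∉L)) tr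
      where
      -- `covered L` lists 2j + 1 of the 2n + 1 vertices, the extra one being h.
      room : + 0 ℤ.≤ sumFin {suc (n ℕ.+ n)} (const (+ 1)) - + 1 - + length (covered L)
      room = subst₂ (λ s l → + 0 ℤ.≤ s - + 1 - + l)
        (sym (trans (sumFin-const (suc (n ℕ.+ n)) (+ 1)) (ℤ.*-identityʳ (+ suc (n ℕ.+ n)))))
        (sym (length-covered tr))
        (ℤ.i≤j⇒0≤j-i (ℤ.+≤+ (ℕ.+-mono-<-≤ j<n (ℕ.<⇒≤ j<n))))

    abstract
      transversal : ∀ j → j ℕ.≤ n → ∃ (Transversal j)
      transversal zero    _   = [] , []
      transversal (suc j) j<n = extend j<n (proj₂ (transversal j (ℕ.<⇒≤ j<n)))

    L : List V
    L = proj₁ (transversal n ℕ.≤-refl)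

    tr : Transversal n L
    tr = proj₂ (transversal n ℕ.≤-refl)

    place : V → V
    place zero    = h
    place (suc i) = vertex L (toℕ i)

    place-≢h : ∀ i → place (suc i) ≢ h
    place-≢h i = vertex-≢h tr (toℕ i) (Finₚ.toℕ<n i)

    place-injective : ∀ {u v} → place u ≡ place v → u ≡ v
    place-injective {zero}  {zero}  _ = refl
    place-injective {zero}  {suc j} e = contradiction (sym e) (place-≢h j)
    place-injective {suc i} {zero}  e = contradiction e (place-≢h i)
    place-injective {suc i} {suc j} e =
      cong suc (Finₚ.toℕ-injective (vertex-injective tr (toℕ i) (toℕ j) (Finₚ.toℕ<n i) (Finₚ.toℕ<n j) e))

    place-partner : ∀ i → place (suc (partner n i)) ≡ mate (place (suc i))
    place-partner i = trans (cong (vertex L) (toℕ-partner n i)) (vertex-flip L (toℕ i))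

    place-adj : ∀ u v → adj G (place u) (place v) ≡ adj (friendship n) u v
    place-adj zero    zero    = irrfl G h
    place-adj zero    (suc j) = ~-sym (Nbrs.first (mate-nbrs (place-≢h j)))
    place-adj (suc i) zero    = Nbrs.first (mate-nbrs (place-≢h i))
    place-adj (suc i) (suc j) = trans (leaves (partner n i Finₚ.≟ j)) (sym (friendship-leaves n i j))
      where
      leaves : Dec (partner n i ≡ j) → adj G (place (suc i)) (place (suc j)) ≡ (toℕ (partner n i) ≡ᵇ toℕ j)
      leaves (yes refl) = trans (trans (cong (adj G (place (suc i))) (place-partner i)) (Nbrs.second (mate-nbrs (place-≢h i))))
        (sym (Bool.T-≡ .Equivalence.to (ℕ.≡⇒≡ᵇ (toℕ (partner n i)) (toℕ j) refl)))
      leaves (no partner≢j) = trans (Bool.¬-not not-adjacent)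
        (sym (Bool.¬-not λ e → partner≢j (Finₚ.toℕ-injective (ℕ.≡ᵇ⇒≡ (toℕ (partner n i)) (toℕ j) (Bool.T-≡ .Equivalence.from e)))))
        where
        not-adjacent : ¬ place (suc i) ~ place (suc j)
        not-adjacent i~j with Nbrs.only (mate-nbrs (place-≢h i)) i~j
        ... | inj₁ e = place-≢h j e
        ... | inj₂ e = partner≢j (Finₚ.suc-injective (place-injective (trans (place-partner i) (sym e))))

  windmill⇒friendship : Isomorphic G (friendship n)
  windmill⇒friendship =
    mk↔ₛ′ find place (λ v → place-injective (found (place v))) found ,
    λ u v → trans (cong₂ (adj G) (sym (found u)) (sym (found v))) (place-adj (find u) (find v))
    where
    find : V → V
    find v = proj₁ (injective⇒inverse place place-injective v)
    found : ∀ v → place (find v) ≡ v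
    found v = proj₂ (injective⇒inverse place place-injective v)

-- The case n = 1 and the conclusion

windmill-3 : (G : SimpleGraph 3) → trace (adjMatrix G) 2 ≡ + 6 → Windmill G zero
windmill-3 G edges = windmill
  where
  open Adjacency G
  codegree : Vector 3
  codegree v = sumFin (non-neighbours v)
  -- The degrees sum to 6 = 3 · 2, so no two distinct vertices are non-adjacent.
  codegree-total : sumFin codegree ≡ + 0
  codegree-total = trans (sumFin-cong {3} non-neighbours-total)
    (trans (sumFin-- {3} (const (+ 2)) degree) (cong (_-_ (+ 6)) (trans (sym (sumFin-cong {3} walk²-diag)) edges)))
  complete : ∀ {u v} → u ≢ v → u ~ v
  complete {u} = dominating (sym (ℤ.i-j≡0⇒i≡j (+ 2) (degree u) (trans (sym (non-neighbours-total u))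
    (sumFin≡0⇒term≡0 (λ v → sumFin-nonneg (non-neighbours-nonneg v)) codegree-total u))))
  windmill : Windmill G zero
  windmill zero             0≢0 = contradiction refl 0≢0
  windmill (suc zero)       _   = suc (suc zero) , record
    { distinct = λ () ; first = complete (λ ()) ; second = complete (λ ()) ; only = only }
    where
    only : ∀ {u} → suc zero ~ u → u ≡ zero ⊎ u ≡ suc (suc zero)
    only {zero}           _   = inj₁ refl
    only {suc zero}       u~u = contradiction refl (~⇒≢ u~u)
    only {suc (suc zero)} _   = inj₂ refl
  windmill (suc (suc zero)) _   = suc zero , record
    { distinct = λ () ; first = complete (λ ()) ; second = complete (λ ()) ; only = only }
    where
    only : ∀ {u} → suc (suc zero) ~ u → u ≡ zero ⊎ u ≡ suc zero
    only {zero}           _   = inj₁ refl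
    only {suc zero}       _   = inj₂ refl
    only {suc (suc zero)} u~u = contradiction refl (~⇒≢ u~u)

cospectral⇒windmill : (n : ℕ) → 1 ≤ n → (G : SimpleGraph (suc (n ℕ.+ n))) →
  Connected G → Cospectral G (friendship n) → ∃ λ h → Windmill G h
cospectral⇒windmill n 1≤n G connected cospectral = hub n 1≤n G connected annihilates edges
  where
  A F : Matrix (suc (n ℕ.+ n))
  A = adjMatrix G
  F = adjMatrix (friendship n)
  same-trace : ∀ e → trace A e ≡ trace F e
  same-trace = cospectral⇒trace (Adjacency.A-sym G) (Adjacency.A-sym (friendship n)) cospectral
  annihilates : ∀ x u → quartic A (+ (n ℕ.+ n)) x u ≡ + 0
  annihilates = quartic-trace A F (+ (n ℕ.+ n)) (Adjacency.A-sym G) same-trace (Friendship.quartic≡0 n)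
  edges : trace A 2 ≡ + 3 * + (n ℕ.+ n)
  edges = trans (same-trace 2) (Friendship.trace² n)
  hub : ∀ n → 1 ≤ n → (G : SimpleGraph (suc (n ℕ.+ n))) → Connected G →
    (∀ x u → quartic (adjMatrix G) (+ (n ℕ.+ n)) x u ≡ + 0) → trace (adjMatrix G) 2 ≡ + 3 * + (n ℕ.+ n) →
    ∃ λ h → Windmill G h
  hub (suc zero) _ G _ _ edges = zero , windmill-3 G edges
  -- From n = 2 on, N = 2n has the form 3 + k that `Classification` asks for.
  hub (suc (suc n)) _ G connected annihilates edges = Classification.windmill (n ℕ.+ suc n) (cong suc size) G connected
    (subst (λ N → ∀ x u → quartic (adjMatrix G) (+ N) x u ≡ + 0) size annihilates)
    (subst (λ N → trace (adjMatrix G) 2 ≡ + 3 * + N) size edges)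
    where
    size : suc (suc n) ℕ.+ suc (suc n) ≡ 3 ℕ.+ (n ℕ.+ suc n)
    size = cong (λ k → suc (suc k)) (ℕ.+-suc n (suc n))

theorem1p1 : (n : ℕ) → 1 ≤ n → (m : ℕ) → (G : SimpleGraph m) →
    Connected G → Cospectral G (friendship n) → Isomorphic G (friendship n)
theorem1p1 n 1≤n m G connected cospectral =
  from-size (charMatrix-degree (adjMatrix G) (adjMatrix (friendship n)) cospectral) G connected cospectral
  where
  from-size : ∀ {m} → m ≡ suc (n ℕ.+ n) → (G : SimpleGraph m) →
    Connected G → Cospectral G (friendship n) → Isomorphic G (friendship n)
  from-size refl G connected cospectral =
    let h , windmill = cospectral⇒windmill n 1≤n G connected cospectral in windmill⇒friendship n G h windmill
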